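{- Let $\Phi\subset\mathbb{R}^n$ be an irreducible crystallographic root system with positive system $\Phi^+$ and corresponding simple system $\Delta\subseteq\Phi^+$, and let $W$ be the corresponding Weyl group. If $\alpha,\beta\in\Phi^+$ are incomparable, then there is $w\in W$ with $w\Delta\cap\Phi^+=\{\alpha,\beta\}$.
   Context: A root system is a finite nonempty set $\Phi\subset\mathbb{R}^n\setminus\{0\}$ with $\Phi\cap\mathbb{R}\alpha=\{ -\alpha,\alpha\}$ and $s_\alpha(\Phi)=\Phi$ for all $\alpha\in\Phi$, where $s_\alpha(x)=x-2\frac{\alpha^tx}{\alpha^t\alpha}\alpha$. It is irreducible if it has no partition into two nonempty subsets $\Phi',\Phi''$ with $\alpha^t\beta=0$ for all $\alpha\in\Phi',\beta\in\Phi''$; it is crystallographic if $\frac{2\alpha^t\beta}{\alpha^t\alpha}\in\mathbb{Z}$ for all $\alpha,\beta\in\Phi$. The Weyl group $W$ is the group generated by the reflections $s_\alpha$, $\alpha\in\Phi$. A positive system is $\Phi^+=\Phi\cap\{x : c^tx>0\}$ for some $c\in\mathbb{R}^n$ with $c^t\alpha\neq0$ for all $\alpha\in\Phi$. The simple system $\Delta\subseteq\Phi^+$ is the unique minimal set of generators of the cone $C=\operatorname{cone}(\Phi^+)$. Write $\alpha\preceq\beta$ if $\beta-\alpha\in C$ (on $\Phi^+$ this is the root poset). Two roots $\alpha,\beta\in\Phi^+$ are incomparable if neither $\alpha-\beta$ nor $\beta-\alpha$ lies in $C$. -}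

module Defs where

open import Level using (0ℓ)
open import Algebra.Core using (Op₁; Op₂)
open import Algebra.Structures using (IsCommutativeRing)
open import Data.Integer.Base using (ℤ; +_; -[1+_])
open import Data.List.Base using (List; foldr)
open import Data.List.Membership.Propositional using () renaming (_∈_ to _∈ˡ_)
open import Data.List.Relation.Unary.All using (All)
open import Data.Nat.Base using (ℕ; zero; suc)
open import Data.Product.Base using (_×_; _,_; ∃; ∃₂)
open import Data.Vec.Base as Vec using (Vec)
open import Function.Base using (id; _∘_)
open import Relation.Binary.Core using (Rel)
open import Relation.Binary.PropositionalEquality.Core using (_≡_; _≢_; _≗_)
open import Relation.Binary.Structures using (IsStrictTotalOrder)
open import Relation.Nullary.Negation.Core using (¬_)
open import Relation.Unary using (Pred; _⊆_; _≐_; _∩_; _∪_; _⊥_; ｛_｝; Satisfiable)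
import Relation.Binary.Construct.StrictToNonStrict as StrictToNonStrict

-- The classical axioms of the real numbers: a Dedekind-complete ordered
-- field, which is unique up to isomorphism.  The order is trichotomous, as it
-- is classically; the value of 0# ⁻¹ is left unspecified.
record Reals : Set₁ where
  infix  8 _⁻¹
  infix  8 -_
  infixl 7 _*_ _/_
  infixl 6 _+_
  infix  4 _<_
  field
    ℝ                  : Set
    _+_ _*_            : Op₂ ℝ
    -_                 : Op₁ ℝ
    0# 1#              : ℝ
    _⁻¹                : Op₁ ℝ
    _<_                : Rel ℝ 0ℓ
    isCommutativeRing  : IsCommutativeRing _≡_ _+_ _*_ -_ 0# 1#
    0≢1                : 0# ≢ 1#
    *-inverseʳ         : ∀ x → x ≢ 0# → x * x ⁻¹ ≡ 1#
    isStrictTotalOrder : IsStrictTotalOrder _≡_ _<_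
    +-monoʳ-<          : ∀ z {x y} → x < y → z + x < z + y
    *-pos              : ∀ {x y} → 0# < x → 0# < y → 0# < x * y

  open StrictToNonStrict _≡_ _<_ public using (_≤_)

  UpperBound : Pred ℝ 0ℓ → Pred ℝ 0ℓ
  UpperBound S b = ∀ {x} → S x → x ≤ b

  field
    supremum : (S : Pred ℝ 0ℓ) → Satisfiable S → Satisfiable (UpperBound S) →
               ∃ λ s → UpperBound S s × (∀ {b} → UpperBound S b → s ≤ b)

  _/_ : Op₂ ℝ
  x / y = x * y ⁻¹

  2# : ℝ
  2# = 1# + 1#

  fromℕ : ℕ → ℝ
  fromℕ zero    = 0#
  fromℕ (suc k) = 1# + fromℕ k

  fromℤ : ℤ → ℝ
  fromℤ (+ k)    = fromℕ k
  fromℤ -[1+ k ] = - fromℕ (suc k)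

module RootSystems (R : Reals) (n : ℕ) where
  open Reals R public

  V : Set
  V = Vec ℝ n

  infix  8 -ᵛ_
  infixl 7 _·_ _*ᵛ_
  infixl 6 _+ᵛ_ _-ᵛ_

  0ᵛ : V
  0ᵛ = Vec.replicate n 0#

  _+ᵛ_ : Op₂ V
  _+ᵛ_ = Vec.zipWith _+_

  -ᵛ_ : Op₁ V
  -ᵛ_ = Vec.map (-_)

  _-ᵛ_ : Op₂ V
  x -ᵛ y = x +ᵛ (-ᵛ y)

  _*ᵛ_ : ℝ → V → V
  t *ᵛ x = Vec.map (t *_) x

  _·_ : V → V → ℝ
  x · y = Vec.foldr′ _+_ 0# (Vec.zipWith _*_ x y)

  Subset : Set₁
  Subset = Pred V 0ℓ

  Finite : Subset → Set
  Finite S = ∃ λ (xs : List V) → S ≐ (_∈ˡ xs)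

  Line : V → Subset
  Line α x = ∃ λ t → x ≡ t *ᵛ α

  image : (V → V) → Subset → Subset
  image f S y = ∃ λ x → S x × y ≡ f x

  lincomb : List (ℝ × V) → V
  lincomb = foldr (λ (t , v) x → t *ᵛ v +ᵛ x) 0ᵛ

  cone : Subset → Subset
  cone S x = ∃ λ (tvs : List (ℝ × V)) →
    All (λ (t , v) → 0# ≤ t × S v) tvs × x ≡ lincomb tvs

  s : V → V → V
  s α x = x -ᵛ (2# * ((α · x) / (α · α))) *ᵛ α

  record IsRootSystem (Φ : Subset) : Set where
    field
      finite     : Finite Φ
      nonempty   : Satisfiable Φ
      nonzero    : ∀ {α} → Φ α → α ≢ 0ᵛ
      reduced    : ∀ {α} → Φ α → (Φ ∩ Line α) ≐ (｛ -ᵛ α ｝ ∪ ｛ α ｝)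
      reflection : ∀ {α} → Φ α → image (s α) Φ ≐ Φ

  Irreducible : Subset → Set₁
  Irreducible Φ = ¬ (∃₂ λ (Φ′ Φ″ : Subset) →
    Satisfiable Φ′ × Satisfiable Φ″ ×
    (Φ′ ∪ Φ″) ≐ Φ × Φ′ ⊥ Φ″ ×
    (∀ {α β} → Φ′ α → Φ″ β → α · β ≡ 0#))

  Crystallographic : Subset → Set
  Crystallographic Φ = ∀ {α β} → Φ α → Φ β →
    ∃ λ (k : ℤ) → (2# * (α · β)) / (α · α) ≡ fromℤ k

  -- Group generated by the reflections inside the group of bijections V → V:
  -- `inverse` closes under two-sided inverses.
  data Weyl (Φ : Subset) : Pred (V → V) 0ℓ where
    reflection : ∀ {α} → Φ α → Weyl Φ (s α)
    identity   : Weyl Φ id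
    compose    : ∀ {f g} → Weyl Φ f → Weyl Φ g → Weyl Φ (f ∘ g)
    inverse    : ∀ {f g} → Weyl Φ f → f ∘ g ≗ id → g ∘ f ≗ id → Weyl Φ g

  IsPositiveSystem : Subset → Subset → Set
  IsPositiveSystem Φ Φ⁺ = ∃ λ (c : V) →
    (∀ {α} → Φ α → c · α ≢ 0#) × Φ⁺ ≐ (Φ ∩ λ x → 0# < c · x)

  -- Minimality is with respect to inclusion among the generating subsets.
  record IsSimpleSystem (Φ⁺ Δ : Subset) : Set₁ where
    field
      Δ⊆Φ⁺      : Δ ⊆ Φ⁺
      generates : cone Δ ≐ cone Φ⁺
      minimal   : ∀ {Δ′ : Subset} → Δ′ ⊆ Δ → cone Δ′ ≐ cone Φ⁺ → Δ ⊆ Δ′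

  Incomparable : Subset → V → V → Set
  Incomparable Φ⁺ α β = ¬ cone Φ⁺ (α -ᵛ β) × ¬ cone Φ⁺ (β -ᵛ α)

{-# OPTIONS --safe #-}
-- Incomparability says that no root is a multiple of α - β, whence α·β ≤ 0.
-- Subtracting α or adding β to a root aα - bβ with a, b > 0 gives roots again,
-- until a, b < 1, where integrality of the Cartan numbers forces a = b.  So there
-- is no such root: every positive root in the plane E of α and β is a nonnegative
-- combination of α and β.
--
-- Let p be minus the component of c orthogonal to E, perturb p inside the
-- orthogonal complement of E to a g that vanishes on no root outside E, and let
-- f be g with ties broken by c.  Both α and β are exposed among the f-positive
-- roots, hence simple for f.  Any other simple root δ of f has α·δ, β·δ ≤ 0
-- and p·δ ≥ 0; as c + p is a nonnegative combination of α and β, this forces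
-- c·δ ≤ 0.  Finally f and c are related by an element w of W: while some w δ
-- with δ simple for c is f-negative, replace w by w ∘ s δ, which removes the
-- inversion w δ and creates none.

module Submission where

import Algebra.Properties.AbelianGroup as AbelianGroupProperties
import Algebra.Properties.CommutativeSemigroup as CommutativeSemigroupProperties
import Algebra.Properties.Ring as RingProperties
import Algebra.Properties.Semiring.Mult.TCOptimised as Mult
import Algebra.Solver.Ring as RingSolver
import Data.Integer.Properties as ℤ
import Data.Nat.Properties as ℕ
import Data.Vec.Properties as Vec

open import Defs
open import Algebra.Bundles using (CommutativeRing)
open import Algebra.Solver.Ring.AlmostCommutativeRing
  using (AlmostCommutativeRing; fromCommutativeRing; _-Raw-AlmostCommutative⟶_; Induced-equivalence)
open import Data.Empty using (⊥; ⊥-elim)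
open import Data.Integer.Base as ℤ using (ℤ; -[1+_]) renaming (+_ to pos)
open import Data.List.Base using (List; []; _∷_; length; filter)
open import Data.List.Membership.Propositional using (_∈_; lose; find)
open import Data.List.Membership.Propositional.Properties using (∈-filter⁺)
open import Data.List.Properties using (filter-notAll)
open import Data.List.Relation.Unary.All using (All; []; _∷_)
open import Data.List.Relation.Unary.Any as Any using (any?; here; there)
open import Data.Maybe.Base as Maybe using ()
open import Data.Nat.Base as ℕ using (ℕ; zero; suc)
open import Data.Product.Base using (_×_; _,_; ∃; ∃₂; proj₁; proj₂)
open import Data.Sum.Base using (_⊎_; inj₁; inj₂; [_,_]′)
open import Data.Vec.Base as Vec using (Vec; []; _∷_; lookup)
open import Data.Vec.Relation.Binary.Pointwise.Extensional using (ext; Pointwise-≡⇒≡)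
open import Function.Base using (id; _∘_)
open import Relation.Binary.Definitions using (DecidableEquality; WeaklyDecidable; tri<; tri≈; tri>)
open import Relation.Binary.PropositionalEquality
open import Relation.Binary.Structures using (IsStrictTotalOrder)
open import Relation.Nullary.Decidable using (Dec; yes; no; ¬?; _×-dec_; dec⇒maybe)
open import Relation.Nullary.Negation.Core using (¬_)
open import Relation.Unary using (_≐_; _∩_; _∪_; _⊆_; ｛_｝)

-- The sign of p is what makes the remaining simple roots c-negative. An f-positive root has
-- nonpositive inner product with the part of c orthogonal to E, and the part of c inside E is
-- controlled by the obtuseness of simple roots. Perturbing p is essential: if c lies in E, for
-- instance, then p = 0, ties would be broken by c everywhere, and α and β need not be simple for c.
-- Only when all tied roots lie in E does the absence of roots aα - bβ suffice to expose both.
--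
-- Equality of two small coefficients rests on the Cartan integers of α and β having product less
-- than 4, which leaves a handful of cases.
--
-- No simple system of f is ever constructed: it is wΔ. An exposed root must occur in it, since a
-- functional that is positive on all of wΔ cannot vanish at a nonzero point of the cone that wΔ
-- generates.

-- A ring solver with integer coefficients for the abstract reals.

module RealArithmetic (R : Reals) where
  open Reals R

  ring : CommutativeRing _ _
  ring = record { isCommutativeRing = isCommutativeRing }

  open CommutativeRing ring using
    (+-comm; +-identityˡ; +-identityʳ; -‿inverseʳ; semiring; +-abelianGroup; +-commutativeSemigroup)
  open RingProperties (CommutativeRing.ring ring)
    using (-‿distribˡ-*; -‿distribʳ-*; -0#≈0#; -‿involutive)
  open AbelianGroupProperties +-abelianGroup using (⁻¹-∙-comm)
  open CommutativeSemigroupProperties +-commutativeSemigroup using (interchange)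
  open Mult semiring using (1+×; ×-homo-+; ×1-homo-*) renaming (_×_ to _×′_)
  open ≡-Reasoning

  -- Optimised multiples send 0, 1 and 2 definitionally to `0#`, `1#` and `2#`, so solver constants
  -- match hand-written terms. `fromℤ` would send 1 to `1# + 0#`.
  ⟦_⟧ℤ : ℤ → ℝ
  ⟦ pos m ⟧ℤ    = m ×′ 1#
  ⟦ -[1+ m ] ⟧ℤ = - (suc m ×′ 1#)

  ⟦⟧-neg : ∀ i → ⟦ ℤ.- i ⟧ℤ ≡ - ⟦ i ⟧ℤ
  ⟦⟧-neg (pos zero)    = sym -0#≈0#
  ⟦⟧-neg (pos (suc m)) = refl
  ⟦⟧-neg -[1+ m ]      = sym (-‿involutive _)

  ⟦⟧-⊖ : ∀ m n → ⟦ m ℤ.⊖ n ⟧ℤ ≡ m ×′ 1# + - (n ×′ 1#)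
  ⟦⟧-⊖ zero    zero    = sym (-‿inverseʳ 0#)
  ⟦⟧-⊖ zero    (suc n) = sym (+-identityˡ _)
  ⟦⟧-⊖ (suc m) zero    = sym (trans (cong (suc m ×′ 1# +_) -0#≈0#) (+-identityʳ _))
  ⟦⟧-⊖ (suc m) (suc n) = begin
    ⟦ suc m ℤ.⊖ suc n ⟧ℤ                   ≡⟨ cong ⟦_⟧ℤ (ℤ.[1+m]⊖[1+n]≡m⊖n m n) ⟩
    ⟦ m ℤ.⊖ n ⟧ℤ                           ≡⟨ ⟦⟧-⊖ m n ⟩
    m ×′ 1# + - (n ×′ 1#)                  ≡⟨ +-identityˡ _ ⟨
    0# + (m ×′ 1# + - (n ×′ 1#))           ≡⟨ cong (_+ (m ×′ 1# + - (n ×′ 1#))) (-‿inverseʳ 1#) ⟨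
    1# + - 1# + (m ×′ 1# + - (n ×′ 1#))    ≡⟨ interchange 1# (- 1#) _ _ ⟩
    1# + m ×′ 1# + (- 1# + - (n ×′ 1#))    ≡⟨ cong₂ _+_ (sym (1+× m 1#)) (⁻¹-∙-comm 1# _) ⟩
    suc m ×′ 1# + - (1# + n ×′ 1#)         ≡⟨ cong (λ x → suc m ×′ 1# + - x) (1+× n 1#) ⟨
    suc m ×′ 1# + - (suc n ×′ 1#)          ∎

  ⟦⟧-+ : ∀ i j → ⟦ i ℤ.+ j ⟧ℤ ≡ ⟦ i ⟧ℤ + ⟦ j ⟧ℤ
  ⟦⟧-+ (pos m)  (pos n)  = ×-homo-+ 1# m n
  ⟦⟧-+ (pos m)  -[1+ n ] = ⟦⟧-⊖ m (suc n)
  ⟦⟧-+ -[1+ m ] (pos n)  = trans (⟦⟧-⊖ n (suc m)) (+-comm _ _)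
  ⟦⟧-+ -[1+ m ] -[1+ n ] = begin
    - (suc (suc (m ℕ.+ n)) ×′ 1#)          ≡⟨ cong (λ k → - (k ×′ 1#)) (cong suc (sym (ℕ.+-suc m n))) ⟩
    - ((suc m ℕ.+ suc n) ×′ 1#)            ≡⟨ cong -_ (×-homo-+ 1# (suc m) (suc n)) ⟩
    - (suc m ×′ 1# + suc n ×′ 1#)           ≡⟨ ⁻¹-∙-comm _ _ ⟨
    - (suc m ×′ 1#) + - (suc n ×′ 1#)       ∎

  ⟦⟧-*-pos : ∀ m j → ⟦ pos m ℤ.* j ⟧ℤ ≡ m ×′ 1# * ⟦ j ⟧ℤ
  ⟦⟧-*-pos m (pos n)  = trans (cong ⟦_⟧ℤ (sym (ℤ.pos-* m n))) (×1-homo-* m n)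
  ⟦⟧-*-pos m -[1+ n ] = begin
    ⟦ pos m ℤ.* ℤ.- pos (suc n) ⟧ℤ     ≡⟨ cong ⟦_⟧ℤ (ℤ.neg-distribʳ-* (pos m) (pos (suc n))) ⟨
    ⟦ ℤ.- (pos m ℤ.* pos (suc n)) ⟧ℤ   ≡⟨ ⟦⟧-neg (pos m ℤ.* pos (suc n)) ⟩
    - ⟦ pos m ℤ.* pos (suc n) ⟧ℤ       ≡⟨ cong -_ (⟦⟧-*-pos m (pos (suc n))) ⟩
    - (m ×′ 1# * (suc n ×′ 1#))          ≡⟨ -‿distribʳ-* _ _ ⟩
    m ×′ 1# * - (suc n ×′ 1#)            ∎

  ⟦⟧-* : ∀ i j → ⟦ i ℤ.* j ⟧ℤ ≡ ⟦ i ⟧ℤ * ⟦ j ⟧ℤ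
  ⟦⟧-* (pos m)  j = ⟦⟧-*-pos m j
  ⟦⟧-* -[1+ m ] j = begin
    ⟦ ℤ.- pos (suc m) ℤ.* j ⟧ℤ         ≡⟨ cong ⟦_⟧ℤ (ℤ.neg-distribˡ-* (pos (suc m)) j) ⟨
    ⟦ ℤ.- (pos (suc m) ℤ.* j) ⟧ℤ       ≡⟨ ⟦⟧-neg (pos (suc m) ℤ.* j) ⟩
    - ⟦ pos (suc m) ℤ.* j ⟧ℤ           ≡⟨ cong -_ (⟦⟧-*-pos (suc m) j) ⟩
    - (suc m ×′ 1# * ⟦ j ⟧ℤ)            ≡⟨ -‿distribˡ-* _ _ ⟩
    - (suc m ×′ 1#) * ⟦ j ⟧ℤ            ∎

  almostCommutativeRing : AlmostCommutativeRing _ _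
  almostCommutativeRing = fromCommutativeRing ring

  ⟦⟧-morphism : ℤ.+-*-rawRing -Raw-AlmostCommutative⟶ almostCommutativeRing
  ⟦⟧-morphism = record
    { ⟦_⟧ = ⟦_⟧ℤ ; +-homo = ⟦⟧-+ ; *-homo = ⟦⟧-* ; -‿homo = ⟦⟧-neg
    ; 0-homo = refl ; 1-homo = refl }

  _coefficient≟_ : WeaklyDecidable (Induced-equivalence ⟦⟧-morphism)
  i coefficient≟ j = Maybe.map (cong ⟦_⟧ℤ) (dec⇒maybe (i ℤ.≟ j))

  open RingSolver ℤ.+-*-rawRing almostCommutativeRing ⟦⟧-morphism _coefficient≟_
    public using (Polynomial; solve; con; _:+_; _:*_; :-_; _:-_; _:=_)

  :0 :1 :2 : ∀ {m} → Polynomial m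
  :0 = con (pos 0)
  :1 = con (pos 1)
  :2 = con (pos 2)

-- Order of the reals and discreteness of the naturals.

module RealOrder (R : Reals) where
  open Reals R
  open RealArithmetic R
  open IsStrictTotalOrder isStrictTotalOrder using (compare) renaming (trans to <-trans; irrefl to <-irrefl)

  private
    0+0 : 0# + 0# ≡ 0#
    0+0 = solve 0 (:0 :+ :0 := :0) refl

  0<⇒≢0 : ∀ {x} → 0# < x → x ≢ 0#
  0<⇒≢0 0<x x≡0 = <-irrefl (sym x≡0) 0<x

  0<-⇒≢0 : ∀ {x} → 0# < - x → x ≢ 0#
  0<-⇒≢0 0<-x refl = 0<⇒≢0 0<-x (solve 0 (:- :0 := :0) refl)

  <⇒0<∸ : ∀ {x y} → x < y → 0# < y + - x
  <⇒0<∸ {x} {y} x<y = subst₂ _<_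
    (solve 1 (λ x → :- x :+ x := :0) refl x)
    (solve 2 (λ x y → :- x :+ y := y :- x) refl x y)
    (+-monoʳ-< (- x) x<y)

  -- Negative is expressed as `0# < - x` and nonpositive as `0# ≤ - x` throughout: with every
  -- comparison made against zero, rearranging an inequality is a ring identity under `subst`.
  sign : ∀ x → 0# < x ⊎ x ≡ 0# ⊎ 0# < - x
  sign x with compare 0# x
  ... | tri< 0<x _ _ = inj₁ 0<x
  ... | tri≈ _ 0≡x _ = inj₂ (inj₁ (sym 0≡x))
  ... | tri> _ _ x<0 = inj₂ (inj₂ (subst (0# <_)
    (solve 1 (λ x → :0 :- x := :- x) refl x) (<⇒0<∸ x<0)))

  +-pos-nonneg : ∀ {x y} → 0# < x → 0# ≤ y → 0# < x + y
  +-pos-nonneg {x} 0<x 0≤y = helper 0≤y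
    where
    x+0 : x + 0# ≡ x
    x+0 = solve 1 (λ x → x :+ :0 := x) refl x
    helper : ∀ {y} → 0# ≤ y → 0# < x + y
    helper (inj₁ 0<y)  = <-trans (subst (0# <_) (sym x+0) 0<x) (+-monoʳ-< x 0<y)
    helper (inj₂ refl) = subst (0# <_) (sym x+0) 0<x

  +-pos : ∀ {x y} → 0# < x → 0# < y → 0# < x + y
  +-pos 0<x 0<y = +-pos-nonneg 0<x (inj₁ 0<y)

  +-nonneg-pos : ∀ {x y} → 0# ≤ x → 0# < y → 0# < x + y
  +-nonneg-pos {x} {y} 0≤x 0<y = subst (0# <_)
    (solve 2 (λ x y → y :+ x := x :+ y) refl x y) (+-pos-nonneg 0<y 0≤x)

  +-nonneg : ∀ {x y} → 0# ≤ x → 0# ≤ y → 0# ≤ x + y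
  +-nonneg (inj₁ 0<x)  0≤y         = inj₁ (+-pos-nonneg 0<x 0≤y)
  +-nonneg (inj₂ refl) (inj₁ 0<y)  = inj₁ (+-nonneg-pos (inj₂ refl) 0<y)
  +-nonneg (inj₂ refl) (inj₂ refl) = inj₂ (sym 0+0)

  *-nonneg : ∀ {x y} → 0# ≤ x → 0# ≤ y → 0# ≤ x * y
  *-nonneg (inj₁ 0<x)  (inj₁ 0<y)  = inj₁ (*-pos 0<x 0<y)
  *-nonneg {x} (inj₁ _) (inj₂ refl) =
    inj₂ (solve 1 (λ x → :0 := x :* :0) refl x)
  *-nonneg {_} {y} (inj₂ refl) _ =
    inj₂ (solve 1 (λ y → :0 := :0 :* y) refl y)

  pos∧neg : ∀ {x} → 0# < x → 0# ≤ - x → ⊥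
  pos∧neg {x} 0<x 0≤-x = 0<⇒≢0 (+-pos-nonneg 0<x 0≤-x)
    (solve 1 (λ x → x :- x := :0) refl x)

  nonneg⊎neg : ∀ x → 0# ≤ x ⊎ 0# < - x
  nonneg⊎neg x with sign x
  ... | inj₁ 0<x        = inj₁ (inj₁ 0<x)
  ... | inj₂ (inj₁ x≡0) = inj₁ (inj₂ (sym x≡0))
  ... | inj₂ (inj₂ x<0) = inj₂ x<0

  pos⊎nonpos : ∀ x → 0# < x ⊎ 0# ≤ - x
  pos⊎nonpos x with sign x
  ... | inj₁ 0<x         = inj₁ 0<x
  ... | inj₂ (inj₁ refl) = inj₂ (inj₂ (solve 0 (:0 := :- :0) refl))
  ... | inj₂ (inj₂ x<0)  = inj₂ (inj₁ x<0)

  ≢0⇒0<square : ∀ {x} → x ≢ 0# → 0# < x * x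
  ≢0⇒0<square {x} x≢0 with sign x
  ... | inj₁ 0<x        = *-pos 0<x 0<x
  ... | inj₂ (inj₁ x≡0) = ⊥-elim (x≢0 x≡0)
  ... | inj₂ (inj₂ x<0) =
    subst (0# <_) (solve 1 (λ x → :- x :* :- x := x :* x) refl x) (*-pos x<0 x<0)

  0≤square : ∀ x → 0# ≤ x * x
  0≤square x with sign x
  ... | inj₁ 0<x         = inj₁ (≢0⇒0<square (0<⇒≢0 0<x))
  ... | inj₂ (inj₁ refl) = inj₂ (solve 0 (:0 := :0 :* :0) refl)
  ... | inj₂ (inj₂ x<0)  = inj₁ (≢0⇒0<square (0<-⇒≢0 x<0))

  0<1 : 0# < 1#
  0<1 = subst (0# <_) (solve 0 (:1 :* :1 := :1) refl)
    (≢0⇒0<square (λ 1≡0 → 0≢1 (sym 1≡0)))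

  0<2 : 0# < 2#
  0<2 = +-pos 0<1 0<1

  *-cancelˡ-pos : ∀ {x y} → 0# < x → 0# < x * y → 0# < y
  *-cancelˡ-pos {x} {y} 0<x 0<xy with pos⊎nonpos y
  ... | inj₁ 0<y = 0<y
  ... | inj₂ y≤0 = ⊥-elim (pos∧neg 0<xy (subst (0# ≤_)
    (solve 2 (λ x y → x :* :- y := :- (x :* y)) refl x y) (*-nonneg (inj₁ 0<x) y≤0)))

  *-cancelˡ-nonneg : ∀ {x y} → 0# < x → 0# ≤ x * y → 0# ≤ y
  *-cancelˡ-nonneg {x} {y} 0<x 0≤xy with nonneg⊎neg y
  ... | inj₁ 0≤y = 0≤y
  ... | inj₂ y<0 = ⊥-elim (pos∧neg (*-pos 0<x y<0) (subst (0# ≤_)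
    (solve 2 (λ x y → x :* y := :- (x :* :- y)) refl x y) 0≤xy))

  *-cancelˡ-zero : ∀ {x y} → 0# < x → x * y ≡ 0# → y ≡ 0#
  *-cancelˡ-zero {x} {y} 0<x xy≡0 with sign y
  ... | inj₁ 0<y        = ⊥-elim (0<⇒≢0 (*-pos 0<x 0<y) xy≡0)
  ... | inj₂ (inj₁ y≡0) = y≡0
  ... | inj₂ (inj₂ y<0) = ⊥-elim (pos∧neg (*-pos 0<x y<0) (inj₂ (trans (sym xy≡0)
    (solve 2 (λ x y → x :* y := :- (x :* :- y)) refl x y))))

  ⁻¹-pos : ∀ {x} → 0# < x → 0# < x ⁻¹
  ⁻¹-pos {x} 0<x = *-cancelˡ-pos 0<x
    (subst (0# <_) (sym (*-inverseʳ x (0<⇒≢0 0<x))) 0<1)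

  ∸≡0⇒≡ : ∀ {x y} → x + - y ≡ 0# → x ≡ y
  ∸≡0⇒≡ {x} {y} x-y≡0 = trans (solve 2 (λ x y → x := x :- y :+ y) refl x y)
    (trans (cong (_+ y) x-y≡0) (solve 1 (λ y → :0 :+ y := y) refl y))

  fromℕ-nonneg : ∀ k → 0# ≤ fromℕ k
  fromℕ-nonneg zero    = inj₂ refl
  fromℕ-nonneg (suc k) = inj₁ (+-pos-nonneg 0<1 (fromℕ-nonneg k))

  fromℕ-+ : ∀ j k → fromℕ (j ℕ.+ k) ≡ fromℕ j + fromℕ k
  fromℕ-+ zero    k = solve 1 (λ x → x := :0 :+ x) refl (fromℕ k)
  fromℕ-+ (suc j) k = trans (cong (1# +_) (fromℕ-+ j k))
    (solve 2 (λ x y → :1 :+ (x :+ y) := :1 :+ x :+ y) refl (fromℕ j) (fromℕ k))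

  -- Discreteness in additive form; this is how integrality rules out values strictly between
  -- consecutive integers.
  fromℕ-gap : ∀ j k → fromℕ j ≡ fromℕ k ⊎
    0# ≤ fromℕ j + - fromℕ k + - 1# ⊎ 0# ≤ fromℕ k + - fromℕ j + - 1#
  fromℕ-gap zero    zero    = inj₁ refl
  fromℕ-gap zero    (suc k) = inj₂ (inj₂ (subst (0# ≤_)
    (solve 1 (λ x → x := :1 :+ x :- :0 :- :1) refl (fromℕ k))
    (fromℕ-nonneg k)))
  fromℕ-gap (suc j) zero    = inj₂ (inj₁ (subst (0# ≤_)
    (solve 1 (λ x → x := :1 :+ x :- :0 :- :1) refl (fromℕ j))
    (fromℕ-nonneg j)))
  fromℕ-gap (suc j) (suc k) with fromℕ-gap j k
  ... | inj₁ j≡k        = inj₁ (cong (1# +_) j≡k)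
  ... | inj₂ (inj₁ j>k) = inj₂ (inj₁ (subst (0# ≤_) (shift (fromℕ j) (fromℕ k)) j>k))
    where
    shift : ∀ x y → x + - y + - 1# ≡ 1# + x + - (1# + y) + - 1#
    shift = solve 2 (λ x y → x :- y :- :1
      := :1 :+ x :- (:1 :+ y) :- :1) refl
  ... | inj₂ (inj₂ j<k) = inj₂ (inj₂ (subst (0# ≤_) (shift (fromℕ k) (fromℕ j)) j<k))
    where
    shift : ∀ x y → x + - y + - 1# ≡ 1# + x + - (1# + y) + - 1#
    shift = solve 2 (λ x y → x :- y :- :1
      := :1 :+ x :- (:1 :+ y) :- :1) refl

  fromℤ-nonneg : ∀ k → 0# ≤ fromℤ k → ∃ λ m → fromℤ k ≡ fromℕ m
  fromℤ-nonneg (pos m)  _   = m , refl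
  fromℤ-nonneg -[1+ m ] 0≤k =
    ⊥-elim (pos∧neg (+-pos-nonneg 0<1 (fromℕ-nonneg m)) 0≤k)

-- Linear combinations of vectors and the inner product.

module Linear (R : Reals) (n : ℕ) where
  open RootSystems R n
  open RealArithmetic R
  open RealOrder R

  record IsLinear (L : V → ℝ) : Set where
    field
      +-homo : ∀ x y → L (x +ᵛ y) ≡ L x + L y
      *-homo : ∀ t x → L (t *ᵛ x) ≡ t * L x

  infixl 6 _⊕_ _⊖_
  infixr 7 _⊛_

  -- Reflected vector expressions, through which a vector identity becomes a scalar identity that
  -- the ring solver can prove.
  data Combination : Set where
    ′_  : V → Combination
    𝟎   : Combination
    _⊕_ : Combination → Combination → Combination
    _⊖_ : Combination → Combination → Combination
    ⊖_  : Combination → Combination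
    _⊛_ : ℝ → Combination → Combination

  ⟪_⟫ : Combination → V
  ⟪ ′ x ⟫   = x
  ⟪ 𝟎 ⟫     = 0ᵛ
  ⟪ e ⊕ f ⟫ = ⟪ e ⟫ +ᵛ ⟪ f ⟫
  ⟪ e ⊖ f ⟫ = ⟪ e ⟫ -ᵛ ⟪ f ⟫
  ⟪ ⊖ e ⟫   = -ᵛ ⟪ e ⟫
  ⟪ t ⊛ e ⟫ = t *ᵛ ⟪ e ⟫

  apply : (V → ℝ) → Combination → ℝ
  apply L (′ x)   = L x
  apply L 𝟎       = 0#
  apply L (e ⊕ f) = apply L e + apply L f
  apply L (e ⊖ f) = apply L e + - apply L f
  apply L (⊖ e)   = - apply L e
  apply L (t ⊛ e) = t * apply L e

  -ᵛ≡-1*ᵛ : ∀ x → -ᵛ x ≡ (- 1#) *ᵛ x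
  -ᵛ≡-1*ᵛ = Vec.map-cong (solve 1 (λ x → :- x := :- :1 :* x) refl)

  0ᵛ≡0*ᵛ : 0ᵛ ≡ 0# *ᵛ 0ᵛ
  0ᵛ≡0*ᵛ = sym (trans (Vec.map-replicate (0# *_) 0# n)
    (cong (Vec.replicate n) (solve 0 (:0 :* :0 := :0) refl)))

  module _ {L : V → ℝ} (isLinear : IsLinear L) where
    open IsLinear isLinear

    -homo : ∀ x → L (-ᵛ x) ≡ - L x
    -homo x = trans (cong L (-ᵛ≡-1*ᵛ x)) (trans (*-homo (- 1#) x)
      (solve 1 (λ y → :- :1 :* y := :- y) refl (L x)))

    apply-correct : ∀ e → L ⟪ e ⟫ ≡ apply L e
    apply-correct (′ x)   = refl
    apply-correct 𝟎       = trans (cong L 0ᵛ≡0*ᵛ) (trans (*-homo 0# 0ᵛ)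
      (solve 1 (λ y → :0 :* y := :0) refl (L 0ᵛ)))
    apply-correct (e ⊕ f) =
      trans (+-homo ⟪ e ⟫ ⟪ f ⟫) (cong₂ _+_ (apply-correct e) (apply-correct f))
    apply-correct (e ⊖ f) = trans (+-homo ⟪ e ⟫ (-ᵛ ⟪ f ⟫))
      (cong₂ _+_ (apply-correct e) (trans (-homo ⟪ f ⟫) (cong -_ (apply-correct f))))
    apply-correct (⊖ e)   = trans (-homo ⟪ e ⟫) (cong -_ (apply-correct e))
    apply-correct (t ⊛ e) = trans (*-homo t ⟪ e ⟫) (cong (t *_) (apply-correct e))

  lookup-isLinear : ∀ i → IsLinear (λ x → lookup x i)
  lookup-isLinear i = record
    { +-homo = λ x y → Vec.lookup-zipWith _+_ i x y
    ; *-homo = λ t x → Vec.lookup-map i (t *_) x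
    }

  -- The coordinate functions are the only instances used. The premise can range over arbitrary `L`
  -- because linearity is already spent in `apply`: the solver sees the values `L x` as atoms.
  combination-≡ : ∀ e f → (∀ (L : V → ℝ) → apply L e ≡ apply L f) → ⟪ e ⟫ ≡ ⟪ f ⟫
  combination-≡ e f e≡f = Pointwise-≡⇒≡ (ext λ i →
    trans (apply-correct (lookup-isLinear i) e)
      (trans (e≡f _) (sym (apply-correct (lookup-isLinear i) f))))

  private
    dot : ∀ {m} → Vec ℝ m → Vec ℝ m → ℝ
    dot x y = Vec.foldr′ _+_ 0# (Vec.zipWith _*_ x y)

    dot-+ : ∀ {m} (x y z : Vec ℝ m) → dot x (Vec.zipWith _+_ y z) ≡ dot x y + dot x z
    dot-+ []       []       []       = solve 0 (:0 := :0 :+ :0) refl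
    dot-+ (a ∷ x) (b ∷ y) (c ∷ z) = trans (cong (a * (b + c) +_) (dot-+ x y z))
      (solve 5 (λ a b c p q → a :* (b :+ c) :+ (p :+ q) := a :* b :+ p :+ (a :* c :+ q))
        refl a b c (dot x y) (dot x z))

    dot-* : ∀ {m} t (x y : Vec ℝ m) → dot x (Vec.map (t *_) y) ≡ t * dot x y
    dot-* t []       []       = solve 1 (λ t → :0 := t :* :0) refl t
    dot-* t (a ∷ x) (b ∷ y) = trans (cong (a * (t * b) +_) (dot-* t x y))
      (solve 4 (λ t a b p → a :* (t :* b) :+ t :* p := t :* (a :* b :+ p)) refl t a b (dot x y))

    dot-comm : ∀ {m} (x y : Vec ℝ m) → dot x y ≡ dot y x
    dot-comm []       []      = refl
    dot-comm (a ∷ x) (b ∷ y) = cong₂ _+_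
      (solve 2 (λ a b → a :* b := b :* a) refl a b) (dot-comm x y)

    dot-nonneg : ∀ {m} (x : Vec ℝ m) → 0# ≤ dot x x
    dot-nonneg []      = inj₂ refl
    dot-nonneg (a ∷ x) = +-nonneg (0≤square a) (dot-nonneg x)

    dot-definite : ∀ {m} (x : Vec ℝ m) → 0# < dot x x ⊎ x ≡ Vec.replicate m 0#
    dot-definite []      = inj₂ refl
    dot-definite (a ∷ x) with dot-definite x | sign a
    ... | inj₁ 0<x  | _                = inj₁ (+-nonneg-pos (0≤square a) 0<x)
    ... | inj₂ refl | inj₂ (inj₁ refl) = inj₂ refl
    ... | inj₂ _    | inj₁ 0<a         =
      inj₁ (+-pos-nonneg (≢0⇒0<square (0<⇒≢0 0<a)) (dot-nonneg x))
    ... | inj₂ _    | inj₂ (inj₂ a<0)  =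
      inj₁ (+-pos-nonneg (≢0⇒0<square (0<-⇒≢0 a<0)) (dot-nonneg x))

  ·-comm : ∀ x y → x · y ≡ y · x
  ·-comm = dot-comm

  ·-isLinear : ∀ x → IsLinear (x ·_)
  ·-isLinear x = record { +-homo = dot-+ x ; *-homo = λ t y → dot-* t x y }

  ·-linearʳ : ∀ x e → x · ⟪ e ⟫ ≡ apply (x ·_) e
  ·-linearʳ x = apply-correct (·-isLinear x)

  ·-linearˡ : ∀ e x → ⟪ e ⟫ · x ≡ apply (x ·_) e
  ·-linearˡ e x = trans (·-comm ⟪ e ⟫ x) (·-linearʳ x e)

  ·-definite : ∀ x → 0# < x · x ⊎ x ≡ 0ᵛ
  ·-definite = dot-definite

-- Arithmetic of Cartan integers for coefficients below 1.

module SmallMultiples (R : Reals) where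
  open Reals R
  open RealArithmetic R
  open RealOrder R

  -- The situation of a root aα - bβ with 0 < a, b < 1, where A = α·α, B = β·β
  -- and Q = -α·β: its Cartan integers against α and β are M and -N, those of
  -- the pair α, β are -q and -p.
  record SmallCoefficients (A B Q a b : ℝ) (p q M N : ℕ) : Set where
    field
      0<A : 0# < A
      0<B : 0# < B
      0≤Q : 0# ≤ Q
      0<D : 0# < A * B + - (Q * Q)
      qA  : fromℕ q * A ≡ 2# * Q
      pB  : fromℕ p * B ≡ 2# * Q
      0<a : 0# < a
      0<b : 0# < b
      a<1 : 0# < 1# + - a
      b<1 : 0# < 1# + - b
      M≡  : fromℕ M ≡ 2# * a + b * fromℕ q
      N≡  : fromℕ N ≡ 2# * b + a * fromℕ p

  flip : ∀ {A B Q a b p q M N} → SmallCoefficients A B Q a b p q M N →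
         SmallCoefficients B A Q b a q p N M
  flip {A} {B} {Q} S = record
    { 0<A = 0<B ; 0<B = 0<A ; 0≤Q = 0≤Q
    ; 0<D = subst (0# <_) (solve 3 (λ A B Q → A :* B :- Q :* Q := B :* A :- Q :* Q) refl A B Q) 0<D
    ; qA = pB ; pB = qA ; 0<a = 0<b ; 0<b = 0<a ; a<1 = b<1 ; b<1 = a<1 ; M≡ = N≡ ; N≡ = M≡ }
    where open SmallCoefficients S

  doubled≡1 : ∀ m {x} → 0# < x → 0# < 1# + - x → fromℕ m ≡ 2# * x → 2# * x ≡ 1#
  doubled≡1 m {x} 0<x x<1 m≡ with fromℕ-gap m 1
  ... | inj₁ m≡1        = trans (sym m≡) (trans m≡1 (solve 0 (:1 :+ :0 := :1) refl))
  ... | inj₂ (inj₁ m>1) = ⊥-elim (pos∧neg (+-pos x<1 x<1) (subst (0# ≤_)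
    (trans (cong (λ y → y + - (1# + 0#) + - 1#) m≡)
      (solve 1 (λ x → :2 :* x :- (:1 :+ :0) :- :1
        := :- (:1 :- x :+ (:1 :- x))) refl x)) m>1))
  ... | inj₂ (inj₂ m<1) = ⊥-elim (pos∧neg (+-pos 0<x 0<x) (subst (0# ≤_)
    (trans (cong (λ y → 1# + 0# + - y + - 1#) m≡)
      (solve 1 (λ x → :1 :+ :0 :- :2 :* x :- :1
        := :- (x :+ x)) refl x)) m<1))

  no-gap : ∀ m k {x} → 0# < x → 0# < 1# + - x → fromℕ m + - fromℕ k ≡ x → ⊥
  no-gap m k {x} 0<x x<1 m-k≡x with fromℕ-gap m k
  ... | inj₁ m≡k        = 0<⇒≢0 0<x (trans (sym m-k≡x)
    (trans (cong (λ y → y + - fromℕ k) m≡k) (solve 1 (λ y → y :- y := :0) refl (fromℕ k))))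
  ... | inj₂ (inj₁ m>k) = pos∧neg x<1 (subst (0# ≤_)
    (trans (cong (_+ - 1#) m-k≡x)
      (solve 1 (λ x → x :- :1 := :- (:1 :- x)) refl x)) m>k)
  ... | inj₂ (inj₂ m<k) = pos∧neg (+-pos 0<x 0<1) (subst (0# ≤_)
    (trans (solve 2 (λ m k → k :- m :- :1 := :- (m :- k :+ :1)) refl (fromℕ m) (fromℕ k))
      (cong (λ y → - (y + 1#)) m-k≡x)) m<k)

  -- Here α and β are orthogonal, so 2a and 2b are themselves integers strictly between 0 and 2, and
  -- both equal 1.
  equal-multiples-zero : ∀ {A B Q a b q M N} → SmallCoefficients A B Q a b 0 q M N → a ≡ b
  equal-multiples-zero {A} {B} {Q} {a} {b} {q} {M} {N} S =
    ∸≡0⇒≡ (*-cancelˡ-zero 0<2 (trans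
      (solve 2 (λ a b → :2 :* (a :- b) := :2 :* a :- :2 :* b) refl a b)
      (trans (cong₂ (λ x y → x + - y) (doubled≡1 M 0<a a<1 M≡2a) (doubled≡1 N 0<b b<1 N≡2b))
        (solve 0 (:1 :- :1 := :0) refl))))
    where
    open SmallCoefficients S
    2Q≡0 : 2# * Q ≡ 0#
    2Q≡0 = trans (sym pB) (solve 1 (λ B → :0 :* B := :0) refl B)
    q≡0 : fromℕ q ≡ 0#
    q≡0 = *-cancelˡ-zero 0<A (trans (solve 2 (λ x y → x :* y := y :* x) refl A (fromℕ q)) (trans qA 2Q≡0))
    M≡2a : fromℕ M ≡ 2# * a
    M≡2a = trans M≡ (trans (cong (λ x → 2# * a + b * x) q≡0)
      (solve 2 (λ a b → :2 :* a :+ b :* :0 := :2 :* a) refl a b))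
    N≡2b : fromℕ N ≡ 2# * b
    N≡2b = trans N≡ (solve 2 (λ a b → :2 :* b :+ a :* :0 := :2 :* b) refl a b)

  -- A combination of M and N isolates a quantity of absolute value below 1: M - N is a - b for q =
  -- 1 and a for q = 2, while 2N - M is b for q = 3.
  equal-multiples-one : ∀ {A B Q a b} q {M N} → SmallCoefficients A B Q a b 1 q M N → a ≡ b
  equal-multiples-one {A} {B} {Q} 0 S = sym (equal-multiples-zero (flip S))
  equal-multiples-one {a = a} {b} 1 {M} {N} S with sign (a + - b)
  ... | inj₂ (inj₁ a-b≡0) = ∸≡0⇒≡ a-b≡0
  ... | inj₁ a>b          = ⊥-elim (no-gap M N a>b
    (subst (0# <_) (solve 2 (λ a b → :1 :- a :+ b := :1 :- (a :- b)) refl a b) (+-pos a<1 0<b))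
    (trans (cong₂ (λ x y → x + - y) M≡ N≡) (solve 2 (λ a b →
      :2 :* a :+ b :* (:1 :+ :0) :- (:2 :* b :+ a :* (:1 :+ :0))
      := a :- b) refl a b)))
    where open SmallCoefficients S
  ... | inj₂ (inj₂ a<b)   = ⊥-elim (no-gap N M a<b
    (subst (0# <_) (solve 2 (λ a b → :1 :- b :+ a := :1 :- :- (a :- b)) refl a b) (+-pos b<1 0<a))
    (trans (cong₂ (λ x y → y + - x) M≡ N≡) (solve 2 (λ a b →
      :2 :* b :+ a :* (:1 :+ :0) :- (:2 :* a :+ b :* (:1 :+ :0))
      := :- (a :- b)) refl a b)))
    where open SmallCoefficients S
  equal-multiples-one {a = a} {b} 2 {M} {N} S = ⊥-elim (no-gap M N 0<a a<1
    (trans (cong₂ (λ x y → x + - y) M≡ N≡) (solve 2 (λ a b →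
      :2 :* a :+ b :* (:1 :+ (:1 :+ :0))
        :- (:2 :* b :+ a :* (:1 :+ :0))
      := a) refl a b)))
    where open SmallCoefficients S
  equal-multiples-one {a = a} {b} 3 {M} {N} S = ⊥-elim (no-gap (N ℕ.+ N) M 0<b b<1
    (trans (cong₂ (λ x y → y + - x) M≡ (trans (fromℕ-+ N N) (cong₂ _+_ N≡ N≡))) (solve 2 (λ a b →
      (:2 :* b :+ a :* (:1 :+ :0)) :+ (:2 :* b :+ a :* (:1 :+ :0))
        :- (:2 :* a :+ b :* (:1 :+ (:1 :+ (:1 :+ :0))))
      := b) refl a b)))
    where open SmallCoefficients S
  -- Now B = 2Q and 4A ≤ 2Q, so AB ≤ Q², against the positivity of the Gram determinant.
  equal-multiples-one {A} {B} {Q} (suc (suc (suc (suc q)))) S =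
    ⊥-elim (pos∧neg (*-pos 0<2 0<D) (subst (0# ≤_) identity
      (*-nonneg 0≤Q (*-nonneg (fromℕ-nonneg q) (inj₁ 0<A)))))
    where
    open SmallCoefficients S
    identity : Q * (fromℕ q * A) ≡ - (2# * (A * B + - (Q * Q)))
    identity = trans
      (solve 3 (λ Q q A → Q :* (q :* A) := Q :* ((:1 :+ (:1 :+ (:1 :+ (:1 :+ q)))) :* A)
        :- con (pos 4) :* A :* Q) refl Q (fromℕ q) A)
      (trans (cong (λ x → Q * x + - (⟦ pos 4 ⟧ℤ * A * Q)) qA)
      (trans (solve 2 (λ A Q → Q :* (:2 :* Q) :- con (pos 4) :* A :* Q
          := :2 :* (Q :* Q) :- :2 :* A :* (:2 :* Q)) refl A Q)
      (trans (cong (λ x → 2# * (Q * Q) + - (2# * A * x)) (sym pB))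
        (solve 3 (λ A B Q → :2 :* (Q :* Q) :- :2 :* A :* ((:1 :+ :0) :* B)
          := :- (:2 :* (A :* B :- Q :* Q))) refl A B Q))))

  dominates : ∀ {A Q} k → 0# < A → fromℕ (suc (suc k)) * A ≡ 2# * Q → 0# ≤ Q + - A
  dominates {A} {Q} k 0<A kA = *-cancelˡ-nonneg 0<2 (subst (0# ≤_)
    (trans (solve 2 (λ k A → k :* A := (:1 :+ (:1 :+ k)) :* A :- :2 :* A) refl (fromℕ k) A)
      (trans (cong (_+ - (2# * A)) kA)
        (solve 2 (λ A Q → :2 :* Q :- :2 :* A := :2 :* (Q :- A)) refl A Q)))
    (*-nonneg (fromℕ-nonneg k) (inj₁ 0<A)))

  both-dominate : ∀ {A B Q} → 0# < A → 0# ≤ Q → 0# ≤ Q + - A → 0# ≤ Q + - B → 0# < A * B + - (Q * Q) → ⊥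
  both-dominate {A} {B} {Q} 0<A 0≤Q Q≥A Q≥B 0<D = pos∧neg 0<D (subst (0# ≤_)
    (solve 3 (λ A B Q → (Q :- A) :* Q :+ A :* (Q :- B) := :- (A :* B :- Q :* Q)) refl A B Q)
    (+-nonneg (*-nonneg Q≥A 0≤Q) (*-nonneg (inj₁ 0<A) Q≥B)))

  -- Since pqAB = 4Q² < 4AB, the integers p and q cannot both be at least 2.
  equal-multiples : ∀ {A B Q a b} p q {M N} → SmallCoefficients A B Q a b p q M N → a ≡ b
  equal-multiples zero          q             S = equal-multiples-zero S
  equal-multiples p             zero          S = sym (equal-multiples-zero (flip S))
  equal-multiples (suc zero)    q             S = equal-multiples-one q S
  equal-multiples p             (suc zero)    S = sym (equal-multiples-one p (flip S))
  equal-multiples (suc (suc p)) (suc (suc q)) S =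
    ⊥-elim (both-dominate 0<A 0≤Q (dominates q 0<A qA) (dominates p 0<B pB) 0<D)
    where open SmallCoefficients S

-- Reflections as linear isometric involutions.

module Reflections (R : Reals) (n : ℕ) where
  open RootSystems R n
  open RealArithmetic R
  open RealOrder R
  open Linear R n

  coefficient : V → V → ℝ
  coefficient α x = 2# * ((α · x) / (α · α))

  coefficient-* : ∀ α x → 0# < α · α → coefficient α x * (α · α) ≡ 2# * (α · x)
  coefficient-* α x 0<α = trans
    (solve 3 (λ A P i → :2 :* (P :* i) :* A := :2 :* P :* (A :* i)) refl (α · α) (α · x) ((α · α) ⁻¹))
    (trans (cong (2# * (α · x) *_) (*-inverseʳ (α · α) (0<⇒≢0 0<α)))
      (solve 1 (λ P → :2 :* P :* :1 := :2 :* P) refl (α · x)))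

  coefficient-linear : ∀ α e → coefficient α ⟪ e ⟫ ≡ apply (coefficient α) e
  coefficient-linear α = apply-correct (record
    { +-homo = λ x y → trans (cong (λ p → 2# * (p / (α · α))) (·-linearʳ α (′ x ⊕ ′ y)))
        (solve 3 (λ p q i → :2 :* ((p :+ q) :* i) := :2 :* (p :* i) :+ :2 :* (q :* i))
          refl (α · x) (α · y) ((α · α) ⁻¹))
    ; *-homo = λ t x → trans (cong (λ p → 2# * (p / (α · α))) (·-linearʳ α (t ⊛ ′ x)))
        (solve 3 (λ t p i → :2 :* (t :* p :* i) := t :* (:2 :* (p :* i)))
          refl t (α · x) ((α · α) ⁻¹))
    })

  s-+ : ∀ α x y → s α (x +ᵛ y) ≡ s α x +ᵛ s α y
  s-+ α x y = trans (cong (λ t → (x +ᵛ y) -ᵛ t *ᵛ α) (coefficient-linear α (′ x ⊕ ′ y)))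
    (combination-≡ ((′ x ⊕ ′ y) ⊖ (coefficient α x + coefficient α y) ⊛ ′ α)
      ((′ x ⊖ coefficient α x ⊛ ′ α) ⊕ (′ y ⊖ coefficient α y ⊛ ′ α))
      (λ L → solve 5 (λ x y p q a → x :+ y :- (p :+ q) :* a := x :- p :* a :+ (y :- q :* a))
        refl (L x) (L y) (coefficient α x) (coefficient α y) (L α)))

  s-* : ∀ α t x → s α (t *ᵛ x) ≡ t *ᵛ s α x
  s-* α t x = trans (cong (λ p → t *ᵛ x -ᵛ p *ᵛ α) (coefficient-linear α (t ⊛ ′ x)))
    (combination-≡ (t ⊛ ′ x ⊖ (t * coefficient α x) ⊛ ′ α) (t ⊛ (′ x ⊖ coefficient α x ⊛ ′ α))
      (λ L → solve 4 (λ t x p a → t :* x :- t :* p :* a := t :* (x :- p :* a))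
        refl t (L x) (coefficient α x) (L α)))

  module _ (α : V) (0<α : 0# < α · α) where

    s-isometry : ∀ x y → s α x · s α y ≡ x · y
    s-isometry x y = begin
      s α x · s α y
        ≡⟨ ·-linearˡ (′ x ⊖ p ⊛ ′ α) (s α y) ⟩
      s α y · x + - (p * (s α y · α))
        ≡⟨ cong₂ (λ u v → u + - (p * v))
             (·-linearˡ (′ y ⊖ q ⊛ ′ α) x) (·-linearˡ (′ y ⊖ q ⊛ ′ α) α) ⟩
      x · y + - (q * (x · α)) + - (p * (α · y + - (q * (α · α))))
        ≡⟨ cong (λ u → x · y + - (q * u) + - (p * (α · y + - (q * (α · α))))) (·-comm x α) ⟩
      x · y + - (q * (α · x)) + - (p * (α · y + - (q * (α · α))))
        ≡⟨ solve 6 (λ u p q a b A → u :- q :* a :- p :* (b :- q :* A)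
             := u :- q :* a :- p :* b :+ q :* (p :* A)) refl (x · y) p q (α · x) (α · y) (α · α) ⟩
      x · y + - (q * (α · x)) + - (p * (α · y)) + q * (p * (α · α))
        ≡⟨ cong (λ u → x · y + - (q * (α · x)) + - (p * (α · y)) + q * u) (coefficient-* α x 0<α) ⟩
      x · y + - (q * (α · x)) + - (p * (α · y)) + q * (2# * (α · x))
        ≡⟨ solve 4 (λ u i a b → u :- :2 :* (b :* i) :* a :- :2 :* (a :* i) :* b :+ :2 :* (b :* i) :* (:2 :* a) := u)
             refl (x · y) ((α · α) ⁻¹) (α · x) (α · y) ⟩
      x · y ∎
      where
      open ≡-Reasoning
      p = coefficient α x
      q = coefficient α y

    coefficient-self : coefficient α α ≡ 2#
    coefficient-self = trans (cong (2# *_) (*-inverseʳ (α · α) (0<⇒≢0 0<α)))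
      (solve 0 (:2 :* :1 := :2) refl)

    s-involutive : ∀ x → s α (s α x) ≡ x
    s-involutive x = trans
      (cong (λ t → s α x -ᵛ t *ᵛ α) (trans (coefficient-linear α (′ x ⊖ p ⊛ ′ α))
        (cong (λ t → p + - (p * t)) coefficient-self)))
      (combination-≡ ((′ x ⊖ p ⊛ ′ α) ⊖ (p + - (p * 2#)) ⊛ ′ α) (′ x)
        (λ L → solve 3 (λ x p a → x :- p :* a :- (p :- p :* :2) :* a := x) refl (L x) p (L α)))
      where p = coefficient α x

    s-self : s α α ≡ -ᵛ α
    s-self = trans (cong (λ t → α -ᵛ t *ᵛ α) coefficient-self)
      (combination-≡ (′ α ⊖ 2# ⊛ ′ α) (⊖ ′ α)
        (λ L → solve 1 (λ a → a :- :2 :* a := :- a) refl (L α)))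

-- Pairs of roots and their Cartan integers.

module CrystallographicRoots (R : Reals) (n : ℕ) {Φ : RootSystems.Subset R n}
  (isRootSystem : RootSystems.IsRootSystem R n Φ)
  (crystallographic : RootSystems.Crystallographic R n Φ) where
  open RootSystems R n
  open RealArithmetic R
  open RealOrder R
  open SmallMultiples R
  open Linear R n
  open Reflections R n
  open IsRootSystem isRootSystem using (nonzero; reduced) renaming (reflection to reflect)

  root-norm : ∀ {α} → Φ α → 0# < α · α
  root-norm {α} Φα = [ (λ 0<α → 0<α) , (λ α≡0 → ⊥-elim (nonzero Φα α≡0)) ]′ (·-definite α)

  root-neg : ∀ {α} → Φ α → Φ (-ᵛ α)
  root-neg Φα = proj₁ (proj₂ (reduced Φα) (inj₁ refl))

  root-neg⁻¹ : ∀ {α β} → α ≡ -ᵛ β → Φ α → Φ β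
  root-neg⁻¹ {_} {β} refl Φα = subst Φ (combination-≡ (⊖ ⊖ ′ β) (′ β)
    (λ L → solve 1 (λ b → :- :- b := b) refl (L β))) (root-neg Φα)

  root-s : ∀ {α γ} → Φ α → Φ γ → Φ (s α γ)
  root-s Φα Φγ = proj₁ (reflect Φα) (_ , Φγ , refl)

  parallel : ∀ {α β} → Φ α → Φ β → Line α β → β ≡ -ᵛ α ⊎ β ≡ α
  parallel Φα Φβ α∥β with proj₁ (reduced Φα) (Φβ , α∥β)
  ... | inj₁ -α≡β = inj₁ (sym -α≡β)
  ... | inj₂ α≡β  = inj₂ (sym α≡β)

  gram : V → V → ℝ
  gram α β = (α · α) * (β · β) + - ((α · β) * (α · β))

  -- The vector (α·α)β - (α·β)α has squared length α·α times the Gram determinant. If it vanishes, β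
  -- lies on the line of α, where reducedness leaves only α and its negative.
  cauchy-schwarz : ∀ {α β} → Φ α → Φ β → 0# < gram α β ⊎ β ≡ -ᵛ α ⊎ β ≡ α
  cauchy-schwarz {α} {β} Φα Φβ with ·-definite ⟪ e ⟫
    where e = (α · α) ⊛ ′ β ⊖ (α · β) ⊛ ′ α
  ... | inj₁ 0<e = inj₁ (*-cancelˡ-pos (root-norm Φα) (subst (0# <_) norm 0<e))
    where
    e = (α · α) ⊛ ′ β ⊖ (α · β) ⊛ ′ α
    norm : ⟪ e ⟫ · ⟪ e ⟫ ≡ (α · α) * gram α β
    norm = trans (·-linearˡ e ⟪ e ⟫) (trans
      (cong₂ (λ u v → (α · α) * u + - ((α · β) * v)) (·-linearˡ e β) (·-linearˡ e α))
      (trans (cong (λ p → (α · α) * ((α · α) * (β · β) + - ((α · β) * p))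
                        + - ((α · β) * ((α · α) * (α · β) + - ((α · β) * (α · α))))) (·-comm β α))
        (solve 3 (λ A B P → A :* (A :* B :- P :* P) :- P :* (A :* P :- P :* A)
          := A :* (A :* B :- P :* P)) refl (α · α) (β · β) (α · β))))
  ... | inj₂ e≡0 = inj₂ (parallel Φα Φβ ((α · β) / (α · α) , β∥α))
    where
    A = α · α
    P = α · β
    β∥α : β ≡ (P / A) *ᵛ α
    β∥α = begin
      β
        ≡⟨ combination-≡ (′ β) (1# ⊛ ′ β) (λ L → solve 1 (λ b → b := :1 :* b) refl (L β)) ⟩
      1# *ᵛ β
        ≡⟨ cong (_*ᵛ β) (*-inverseʳ A (0<⇒≢0 (root-norm Φα))) ⟨
      (A * A ⁻¹) *ᵛ β
        ≡⟨ combination-≡ ((A * A ⁻¹) ⊛ ′ β) (A ⁻¹ ⊛ (A ⊛ ′ β ⊖ P ⊛ ′ α) ⊕ (P / A) ⊛ ′ α)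
             (λ L → solve 5 (λ A i P a b → A :* i :* b := i :* (A :* b :- P :* a) :+ P :* i :* a)
               refl A (A ⁻¹) P (L α) (L β)) ⟩
      A ⁻¹ *ᵛ (A *ᵛ β -ᵛ P *ᵛ α) +ᵛ (P / A) *ᵛ α
        ≡⟨ cong (λ x → A ⁻¹ *ᵛ x +ᵛ (P / A) *ᵛ α) e≡0 ⟩
      A ⁻¹ *ᵛ 0ᵛ +ᵛ (P / A) *ᵛ α
        ≡⟨ combination-≡ (A ⁻¹ ⊛ 𝟎 ⊕ (P / A) ⊛ ′ α) ((P / A) ⊛ ′ α)
             (λ L → solve 2 (λ i x → i :* :0 :+ x := x) refl (A ⁻¹) (P / A * L α)) ⟩
      (P / A) *ᵛ α ∎
      where open ≡-Reasoning

  cartan-nonneg : ∀ {α β} → Φ α → Φ β → 0# ≤ α · β → ∃ λ m → coefficient α β ≡ fromℕ m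
  cartan-nonneg {α} {β} Φα Φβ 0≤αβ with crystallographic Φα Φβ
  ... | k , k≡ = proj₁ natural , trans coefficient≡k (proj₂ natural)
    where
    -- The integrality axiom groups the number as (2p)/A, the reflection as 2(p/A).
    coefficient≡k : coefficient α β ≡ fromℤ k
    coefficient≡k = trans (solve 2 (λ p i → :2 :* (p :* i) := :2 :* p :* i) refl (α · β) ((α · α) ⁻¹)) k≡
    natural = fromℤ-nonneg k (subst (0# ≤_) coefficient≡k
      (*-nonneg (inj₁ 0<2) (*-nonneg 0≤αβ (inj₁ (⁻¹-pos (root-norm Φα))))))

  cartan-norm : ∀ {α β m} → Φ α → coefficient α β ≡ fromℕ m → fromℕ m * (α · α) ≡ 2# * (α · β)
  cartan-norm {α} {β} Φα m≡ = trans (cong (_* (α · α)) (sym m≡)) (coefficient-* α β (root-norm Φα))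

  -- With Cartan integer 1, the reflection `s α` takes β to β - α. The term `1# + 0#` is `fromℕ 1`
  -- unfolded.
  unit-string : ∀ {α β} → Φ α → Φ β → coefficient α β ≡ 1# + 0# → Φ (β -ᵛ α)
  unit-string {α} {β} Φα Φβ c≡1 = subst Φ (trans (cong (λ t → β -ᵛ t *ᵛ α) c≡1)
    (combination-≡ (′ β ⊖ (1# + 0#) ⊛ ′ α) (′ β ⊖ ′ α)
      (λ L → solve 2 (λ a b → b :- (:1 :+ :0) :* a := b :- a) refl (L α) (L β)))) (root-s Φα Φβ)

  -- The product of the two Cartan integers of an acute pair is less than 4,
  -- so one of them is 1.
  acute-difference : ∀ {α β} → Φ α → Φ β → α ≢ β → 0# < α · β → Φ (α -ᵛ β)
  acute-difference {α} {β} Φα Φβ α≢β 0<αβ =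
    let k , k≡ = cartan-nonneg Φα Φβ (inj₁ 0<αβ)
        l , l≡ = cartan-nonneg Φβ Φα (inj₁ (subst (0# <_) (·-comm α β) 0<αβ))
    in cases k l k≡ l≡
    where
    no-zero : ∀ {A x} → 0# * A ≡ x → 0# < x → ⊥
    no-zero {A} 0A≡x 0<x = 0<⇒≢0 0<x (trans (sym 0A≡x) (solve 1 (λ A → :0 :* A := :0) refl A))

    not-opposite : β ≢ -ᵛ α
    not-opposite β≡-α = pos∧neg (root-norm Φα)
      (subst (0# ≤_) (trans (cong (α ·_) β≡-α) (·-linearʳ α (⊖ ′ α))) (inj₁ 0<αβ))

    2Q : ∀ l → coefficient β α ≡ fromℕ l → fromℕ l * (β · β) ≡ 2# * (α · β)
    2Q l l≡ = trans (cartan-norm {β} {α} {l} Φβ l≡) (cong (2# *_) (·-comm β α))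

    cases : ∀ k l → coefficient α β ≡ fromℕ k → coefficient β α ≡ fromℕ l → Φ (α -ᵛ β)
    cases (suc zero) _ k≡1 _ = root-neg⁻¹
      (combination-≡ (′ β ⊖ ′ α) (⊖ (′ α ⊖ ′ β))
        (λ L → solve 2 (λ a b → b :- a := :- (a :- b)) refl (L α) (L β)))
      (unit-string Φα Φβ k≡1)
    cases _ (suc zero) _ l≡1 = unit-string Φβ Φα l≡1
    cases zero _ k≡0 _ = ⊥-elim (no-zero (cartan-norm {α} {β} {0} Φα k≡0) (*-pos 0<2 0<αβ))
    cases _ zero _ l≡0 = ⊥-elim (no-zero (2Q 0 l≡0) (*-pos 0<2 0<αβ))
    cases (suc (suc k)) (suc (suc l)) k≡ l≡ =
      [ (λ 0<gram → ⊥-elim (both-dominate (root-norm Φα) (inj₁ 0<αβ)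
          (dominates k (root-norm Φα) (cartan-norm {α} {β} {suc (suc k)} Φα k≡))
          (dominates l (root-norm Φβ) (2Q (suc (suc l)) l≡)) 0<gram))
      , [ (λ β≡-α → ⊥-elim (not-opposite β≡-α)) , (λ β≡α → ⊥-elim (α≢β (sym β≡α))) ]′
      ]′ (cauchy-schwarz Φα Φβ)

-- No root has coefficients of opposite sign on an incomparable pair.

module SeparatedRoots (R : Reals) (n : ℕ) {Φ : RootSystems.Subset R n}
  (isRootSystem : RootSystems.IsRootSystem R n Φ)
  (crystallographic : RootSystems.Crystallographic R n Φ) where
  open RootSystems R n
  open RealArithmetic R
  open RealOrder R
  open SmallMultiples R
  open Linear R n
  open Reflections R n
  open CrystallographicRoots R n isRootSystem crystallographic

  -- What incomparability contributes to the argument in the plane. All t > 0 are excluded, not just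
  -- t = 1, because small coefficients are only shown to be equal to each other.
  record Separated (α β : V) : Set where
    field
      Φα            : Φ α
      Φβ            : Φ β
      obtuse        : 0# ≤ - (α · β)
      0<gram        : 0# < gram α β
      no-difference : ∀ t → 0# < t → ¬ Φ (t *ᵛ α -ᵛ t *ᵛ β)

  swap-combination : ∀ a b α β → b *ᵛ β -ᵛ a *ᵛ α ≡ -ᵛ (a *ᵛ α -ᵛ b *ᵛ β)
  swap-combination a b α β = combination-≡ (b ⊛ ′ β ⊖ a ⊛ ′ α) (⊖ (a ⊛ ′ α ⊖ b ⊛ ′ β))
    (λ L → solve 4 (λ a b x y → b :* y :- a :* x := :- (a :* x :- b :* y)) refl a b (L α) (L β))

  root-swap : ∀ {a b α β} → Φ (a *ᵛ α -ᵛ b *ᵛ β) → Φ (b *ᵛ β -ᵛ a *ᵛ α)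
  root-swap {a} {b} {α} {β} Φγ = subst Φ (sym (swap-combination a b α β)) (root-neg Φγ)

  separated-swap : ∀ {α β} → Separated α β → Separated β α
  separated-swap {α} {β} S = record
    { Φα = Φβ ; Φβ = Φα
    ; obtuse = subst (λ p → 0# ≤ - p) (·-comm α β) obtuse
    ; 0<gram = subst (0# <_) (trans
        (solve 3 (λ A B P → A :* B :- P :* P := B :* A :- P :* P) refl (α · α) (β · β) (α · β))
        (cong (λ p → (β · β) * (α · α) + - (p * p)) (·-comm α β))) 0<gram
    ; no-difference = λ t 0<t → no-difference t 0<t ∘ root-swap {t} {t}
    }
    where open Separated S

  -- The root aα - bβ is acute to α, so subtracting α gives a root. Its first coefficient stays
  -- positive: if a = 1, the remainder -bβ is a root, whence b = 1 and the original root was the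
  -- excluded α - β.
  separated-descent : ∀ {α β a b} → Separated α β → 0# < b → 0# ≤ a + - 1# →
    Φ (a *ᵛ α -ᵛ b *ᵛ β) → 0# < a + - 1# × Φ ((a + - 1#) *ᵛ α -ᵛ b *ᵛ β)
  separated-descent {α} {β} {a} {b} S 0<b 1≤a Φγ = 1<a 1≤a , Φγ-α
    where
    open Separated S
    γ = a *ᵛ α -ᵛ b *ᵛ β
    e = a ⊛ ′ α ⊖ b ⊛ ′ β

    0<a : 0# < a
    0<a = subst (0# <_) (solve 1 (λ a → a :- :1 :+ :1 := a) refl a) (+-nonneg-pos 1≤a 0<1)

    acute : 0# < γ · α
    acute = subst (0# <_)
      (trans (solve 4 (λ a b A P → a :* A :+ b :* :- P := a :* A :- b :* P) refl a b (α · α) (α · β))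
        (sym (·-linearˡ e α)))
      (+-pos-nonneg (*-pos 0<a (root-norm Φα)) (*-nonneg (inj₁ 0<b) obtuse))

    γ≢α : γ ≢ α
    -- Pairing γ = α with α and with β, then eliminating a, leaves b times the Gram determinant
    -- equal to zero.
    γ≢α γ≡α = 0<⇒≢0 (*-pos 0<b 0<gram) (begin
      b * gram α β
        ≡⟨ solve 5 (λ a b A B P → b :* (A :* B :- P :* P)
             := P :* (a :* A :- b :* P) :- A :* (a :* P :- b :* B)) refl a b A B P ⟩
      P * (a * A + - (b * P)) + - (A * (a * P + - (b * B)))
        ≡⟨ cong₂ (λ x y → P * x + - (A * y)) γα≡ γβ≡ ⟩
      P * A + - (A * P)
        ≡⟨ solve 2 (λ A P → P :* A :- A :* P := :0) refl A P ⟩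
      0# ∎)
      where
      open ≡-Reasoning
      A = α · α
      B = β · β
      P = α · β
      γα≡ : a * A + - (b * P) ≡ A
      γα≡ = trans (sym (·-linearʳ α e)) (cong (α ·_) γ≡α)
      γβ≡ : a * P + - (b * B) ≡ P
      γβ≡ = trans (cong (λ p → a * p + - (b * B)) (·-comm α β))
        (trans (sym (·-linearʳ β e)) (trans (cong (β ·_) γ≡α) (·-comm β α)))

    Φγ-α : Φ ((a + - 1#) *ᵛ α -ᵛ b *ᵛ β)
    Φγ-α = subst Φ (combination-≡ (e ⊖ ′ α) ((a + - 1#) ⊛ ′ α ⊖ b ⊛ ′ β)
      (λ L → solve 4 (λ a b x y → a :* x :- b :* y :- x := (a :- :1) :* x :- b :* y)
        refl a b (L α) (L β))) (acute-difference Φγ Φα γ≢α acute)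

    1<a : 0# ≤ a + - 1# → 0# < a + - 1#
    1<a (inj₁ a>1) = a>1
    1<a (inj₂ a≡1) = ⊥-elim (no-difference 1# 0<1
      (subst₂ (λ x y → Φ (x *ᵛ α -ᵛ y *ᵛ β)) (∸≡0⇒≡ (sym a≡1)) (b≡1 (parallel Φβ Φ-bβ (- b , refl))) Φγ))
      where
      Φ-bβ : Φ ((- b) *ᵛ β)
      Φ-bβ = subst Φ (trans (cong (λ t → t *ᵛ α -ᵛ b *ᵛ β) (sym a≡1))
        (combination-≡ (0# ⊛ ′ α ⊖ b ⊛ ′ β) ((- b) ⊛ ′ β)
          (λ L → solve 3 (λ b x y → :0 :* x :- b :* y := :- b :* y) refl b (L α) (L β)))) Φγ-α
      b≡1 : (- b) *ᵛ β ≡ -ᵛ β ⊎ (- b) *ᵛ β ≡ β → b ≡ 1#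
      b≡1 (inj₁ -bβ≡-β) = ∸≡0⇒≡ (*-cancelˡ-zero (root-norm Φβ) (trans
        (solve 2 (λ b B → B :* (b :- :1) := :- B :- :- b :* B) refl b (β · β))
        (trans (cong₂ (λ x y → x + - y) (sym (·-linearʳ β (⊖ ′ β))) (sym (·-linearʳ β ((- b) ⊛ ′ β))))
          (trans (cong (λ x → β · (-ᵛ β) + - (β · x)) -bβ≡-β)
            (solve 1 (λ x → x :- x := :0) refl (β · (-ᵛ β)))))))
      b≡1 (inj₂ -bβ≡β) = ⊥-elim (pos∧neg (root-norm Φβ) (subst (0# ≤_)
        (trans (solve 2 (λ b B → b :* B := :- (:- b :* B)) refl b (β · β))
          (cong -_ (trans (sym (·-linearʳ β ((- b) ⊛ ′ β))) (cong (β ·_) -bβ≡β))))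
        (*-nonneg (inj₁ 0<b) (inj₁ (root-norm Φβ)))))

  -- q is the Cartan integer of -β against α, and M that of aα - bβ; obtuseness makes both
  -- nonnegative.
  cartan-multiple : ∀ {α β a b} → Separated α β → 0# < a → 0# < b → Φ (a *ᵛ α -ᵛ b *ᵛ β) →
    ∃₂ λ q M → fromℕ q * (α · α) ≡ 2# * - (α · β) × fromℕ M ≡ 2# * a + b * fromℕ q
  cartan-multiple {α} {β} {a} {b} S 0<a 0<b Φγ = proj₁ q , proj₁ M ,
    trans (cartan-norm {m = proj₁ q} Φα (proj₂ q)) (cong (2# *_) (·-linearʳ α (⊖ ′ β))) ,
    (begin
      fromℕ (proj₁ M)
        ≡⟨ proj₂ M ⟨
      coefficient α γ
        ≡⟨ coefficient-linear α (a ⊛ ′ α ⊖ b ⊛ ′ β) ⟩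
      a * coefficient α α + - (b * coefficient α β)
        ≡⟨ solve 4 (λ a b x y → a :* x :- b :* y := x :* a :+ b :* :- y) refl
             a b (coefficient α α) (coefficient α β) ⟩
      coefficient α α * a + b * - coefficient α β
        ≡⟨ cong₂ (λ x y → x * a + b * y) (coefficient-self α (root-norm Φα))
             (sym (coefficient-linear α (⊖ ′ β))) ⟩
      2# * a + b * coefficient α (-ᵛ β)
        ≡⟨ cong (λ x → 2# * a + b * x) (proj₂ q) ⟩
      2# * a + b * fromℕ (proj₁ q) ∎)
    where
    open Separated S
    open ≡-Reasoning
    γ = a *ᵛ α -ᵛ b *ᵛ β
    q = cartan-nonneg Φα (root-neg Φβ) (subst (0# ≤_) (sym (·-linearʳ α (⊖ ′ β))) obtuse)
    M = cartan-nonneg Φα Φγ (subst (0# ≤_)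
      (trans (solve 4 (λ a b A P → a :* A :+ b :* :- P := a :* A :- b :* P) refl a b (α · α) (α · β))
        (sym (·-linearʳ α (a ⊛ ′ α ⊖ b ⊛ ′ β))))
      (inj₁ (+-pos-nonneg (*-pos 0<a (root-norm Φα)) (*-nonneg (inj₁ 0<b) obtuse))))

  separated-small : ∀ {α β a b} → Separated α β → 0# < a → 0# < b → 0# < 1# + - a → 0# < 1# + - b →
    ¬ Φ (a *ᵛ α -ᵛ b *ᵛ β)
  separated-small {α} {β} {a} {b} S 0<a 0<b a<1 b<1 Φγ =
    let q , M , qA , M≡ = cartan-multiple {α} {β} {a} {b} S 0<a 0<b Φγ
        p , N , pB , N≡ = cartan-multiple {β} {α} {b} {a} (separated-swap S) 0<b 0<a (root-swap {a} {b} Φγ)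
        small = record
          { 0<A = root-norm Φα ; 0<B = root-norm Φβ ; 0≤Q = obtuse
          ; 0<D = subst (0# <_) (solve 3 (λ A B P → A :* B :- P :* P := A :* B :- :- P :* :- P)
              refl (α · α) (β · β) (α · β)) 0<gram
          ; qA = qA ; pB = trans pB (cong (λ x → 2# * - x) (·-comm β α))
          ; 0<a = 0<a ; 0<b = 0<b ; a<1 = a<1 ; b<1 = b<1 ; M≡ = M≡ ; N≡ = N≡ }
    in no-difference a 0<a
      (subst (λ t → Φ (a *ᵛ α -ᵛ t *ᵛ β)) (sym (equal-multiples {α · α} {β · β} {(- (α · β))} p q {M} {N} small)) Φγ)
    where open Separated S

  -- Each descent lowers a + b by exactly 1, so a natural number bounding this sum serves as the
  -- termination measure.
  separated-bounded : ∀ k {α β a b} → Separated α β → 0# < a → 0# < b →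
    0# ≤ fromℕ k + - (a + b) → ¬ Φ (a *ᵛ α -ᵛ b *ᵛ β)
  separated-bounded zero {a = a} {b} S 0<a 0<b bound _ = pos∧neg (+-pos 0<a 0<b)
    (subst (0# ≤_) (solve 1 (λ x → :0 :- x := :- x) refl (a + b)) bound)
  separated-bounded (suc k) {α} {β} {a} {b} S 0<a 0<b bound Φγ =
    cases (nonneg⊎neg (a + - 1#)) (nonneg⊎neg (b + - 1#))
    where
    1- : ∀ x → 0# < - (x + - 1#) → 0# < 1# + - x
    1- x = subst (0# <_) (solve 1 (λ x → :- (x :- :1) := :1 :- x) refl x)

    cases : 0# ≤ a + - 1# ⊎ 0# < - (a + - 1#) → 0# ≤ b + - 1# ⊎ 0# < - (b + - 1#) → ⊥
    cases (inj₁ 1≤a) _ =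
      let 0<a-1 , Φγ-α = separated-descent {α} {β} {a} {b} S 0<b 1≤a Φγ in
      separated-bounded k {α} {β} {a + - 1#} {b} S 0<a-1 0<b (subst (0# ≤_)
        (solve 3 (λ k a b → :1 :+ k :- (a :+ b) := k :- (a :- :1 :+ b)) refl (fromℕ k) a b) bound) Φγ-α
    cases (inj₂ _) (inj₁ 1≤b) =
      let 0<b-1 , Φγ+β = separated-descent {β} {α} {b} {a} (separated-swap S) 0<a 1≤b (root-swap {a} {b} Φγ) in
      separated-bounded k {α} {β} {a} {b + - 1#} S 0<a 0<b-1 (subst (0# ≤_)
        (solve 3 (λ k a b → :1 :+ k :- (a :+ b) := k :- (a :+ (b :- :1))) refl (fromℕ k) a b) bound)
        (root-swap {b + - 1#} {a} Φγ+β)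
    cases (inj₂ a<1) (inj₂ b<1) = separated-small {α} {β} {a} {b} S 0<a 0<b (1- a a<1) (1- b b<1) Φγ

  -- The bound on a + b comes from the Cartan integers 2a + bq and 2b + ap
  -- instead of the Archimedean property.
  separated : ∀ {α β a b} → Separated α β → 0# < a → 0# < b → ¬ Φ (a *ᵛ α -ᵛ b *ᵛ β)
  separated {α} {β} {a} {b} S 0<a 0<b Φγ =
    let q , M , _ , M≡ = cartan-multiple {α} {β} {a} {b} S 0<a 0<b Φγ
        p , N , _ , N≡ = cartan-multiple {β} {α} {b} {a} (separated-swap S) 0<b 0<a (root-swap {a} {b} Φγ)
    in separated-bounded (M ℕ.+ N) {α} {β} {a} {b} S 0<a 0<b (subst (0# ≤_) (trans
      (solve 4 (λ a b p q → a :+ b :+ (b :* q :+ a :* p)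
        := :2 :* a :+ b :* q :+ (:2 :* b :+ a :* p) :- (a :+ b)) refl a b (fromℕ p) (fromℕ q))
      (cong (_+ - (a + b)) (trans (cong₂ _+_ (sym M≡) (sym N≡)) (sym (fromℕ-+ M N)))))
      (+-nonneg (inj₁ (+-pos 0<a 0<b)) (+-nonneg
        (*-nonneg (inj₁ 0<b) (fromℕ-nonneg q)) (*-nonneg (inj₁ 0<a) (fromℕ-nonneg p))))) Φγ

-- Lexicographic functionals and the choice of f.

module Functionals (R : Reals) (n : ℕ) {Φ : RootSystems.Subset R n}
  (isRootSystem : RootSystems.IsRootSystem R n Φ)
  (crystallographic : RootSystems.Crystallographic R n Φ) where
  open RootSystems R n
  open RealArithmetic R
  open RealOrder R
  open Linear R n
  open CrystallographicRoots R n isRootSystem crystallographic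
  open SeparatedRoots R n isRootSystem crystallographic
  open IsRootSystem isRootSystem using (finite)

  -- `v` has the sign of `g` at every root where `g` is nonzero; the negative case follows by
  -- passing to opposite roots.
  Refines : V → V → Set
  Refines v g = ∀ {γ} → Φ γ → 0# < g · γ → 0# < v · γ

  refines-neg : ∀ {v g} → Refines v g → ∀ {γ} → Φ γ → 0# < - (g · γ) → 0# < - (v · γ)
  refines-neg {v} {g} v⊒g {γ} Φγ g<0 = subst (0# <_) (·-linearʳ v (⊖ ′ γ))
    (v⊒g (root-neg Φγ) (subst (0# <_) (sym (·-linearʳ g (⊖ ′ γ))) g<0))

  refines-nonneg : ∀ {v g} → Refines v g → ∀ {γ} → Φ γ → 0# < v · γ → 0# ≤ g · γ
  refines-nonneg {v} {g} v⊒g {γ} Φγ 0<v =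
    [ (λ 0≤g → 0≤g) , (λ g<0 → ⊥-elim (pos∧neg 0<v (inj₁ (refines-neg {v} {g} v⊒g Φγ g<0)))) ]′
    (nonneg⊎neg (g · γ))

  refines-zero : ∀ {v g} → Refines v g → ∀ {γ} → Φ γ → v · γ ≡ 0# → g · γ ≡ 0#
  refines-zero {v} {g} v⊒g {γ} Φγ v≡0 with sign (g · γ)
  ... | inj₁ 0<g        = ⊥-elim (0<⇒≢0 (v⊒g Φγ 0<g) v≡0)
  ... | inj₂ (inj₁ g≡0) = g≡0
  ... | inj₂ (inj₂ g<0) = ⊥-elim (0<-⇒≢0 (refines-neg {v} {g} v⊒g Φγ g<0) v≡0)

  domination : ∀ {x} y → 0# < x → ∃ λ N → 0# ≤ N × 0# < N * x + y
  domination {x} y 0<x with nonneg⊎neg y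
  ... | inj₁ 0≤y = 1# , inj₁ 0<1 , subst (0# <_)
    (solve 2 (λ x y → x :+ y := :1 :* x :+ y) refl x y) (+-pos-nonneg 0<x 0≤y)
  -- Chosen to make the sum equal to 1.
  ... | inj₂ y<0 = (1# + - y) * x ⁻¹ , inj₁ (*-pos (+-pos 0<1 y<0) (⁻¹-pos 0<x)) , subst (0# <_)
    (trans (solve 1 (λ y → :1 := (:1 :- y) :* :1 :+ y) refl y)
      (trans (cong (λ t → (1# + - y) * t + y) (sym (*-inverseʳ x (0<⇒≢0 0<x))))
        (solve 3 (λ x i y → (:1 :- y) :* (x :* i) :+ y := (:1 :- y) :* i :* x :+ y) refl x (x ⁻¹) y)))
    0<1

  uniform-domination : ∀ g h (γs : List V) →
    ∃ λ N → 0# ≤ N × (∀ {γ} → γ ∈ γs → 0# < g · γ → 0# < N * (g · γ) + h · γ)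
  uniform-domination g h []       = 0# , inj₂ refl , λ ()
  uniform-domination g h (γ ∷ γs) with uniform-domination g h γs | sign (g · γ)
  ... | N , 0≤N , N-dom | inj₂ g≤0 = N , 0≤N , λ
    { (here refl)  0<g → ⊥-elim ([ 0<⇒≢0 0<g , (λ g<0 → pos∧neg 0<g (inj₁ g<0)) ]′ g≤0)
    ; (there γ∈γs) 0<g → N-dom γ∈γs 0<g }
  ... | N , 0≤N , N-dom | inj₁ 0<g =
    let M , 0≤M , M-dom = domination (h · γ) 0<g in
    -- Enlarging a coefficient that works keeps it working, as `g` is positive at the roots
    -- concerned; so the sum serves the head and the tail at once.
    M + N , +-nonneg 0≤M 0≤N , λ
    { (here refl)          _    → subst (0# <_)
        (solve 4 (λ M N x y → M :* x :+ y :+ N :* x := (M :+ N) :* x :+ y) refl M N (g · γ) (h · γ))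
        (+-pos-nonneg M-dom (*-nonneg 0≤N (inj₁ 0<g)))
    ; {γ′} (there γ∈γs) 0<g′ → subst (0# <_)
        (solve 4 (λ M N x y → N :* x :+ y :+ M :* x := (M :+ N) :* x :+ y) refl M N (g · γ′) (h · γ′))
        (+-pos-nonneg (N-dom γ∈γs 0<g′) (*-nonneg 0≤M (inj₁ 0<g′))) }

  -- The functional Ng + h for N large orders the roots lexicographically by (g, h).
  lexicographic : ∀ g h → ∃ λ v → Refines v g × (∀ γ → g · γ ≡ 0# → v · γ ≡ h · γ)
  lexicographic g h =
    let γs , Φ⊆γs , _ = finite
        N , _ , N-dom = uniform-domination g h γs
        e = N ⊛ ′ g ⊕ ′ h
        v-value : ∀ γ → ⟪ e ⟫ · γ ≡ N * (g · γ) + h · γ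
        v-value γ = trans (·-linearˡ e γ) (cong₂ (λ x y → N * x + y) (·-comm γ g) (·-comm γ h))
    in ⟪ e ⟫ ,
       (λ {γ} Φγ 0<g → subst (0# <_) (sym (v-value γ)) (N-dom (Φ⊆γs Φγ) 0<g)) ,
       (λ γ g≡0 → trans (v-value γ) (trans (cong (λ x → N * x + h · γ) g≡0)
         (solve 2 (λ N y → N :* :0 :+ y := y) refl N (h · γ))))

  Plane : V → V → Subset
  Plane α β γ = ∃₂ λ a b → γ ≡ a *ᵛ α +ᵛ b *ᵛ β

  -- The component of x orthogonal to α and β, scaled by the Gram determinant.
  component : V → V → V → Combination
  component α β x = gram α β ⊛ ′ x
    ⊖ ((β · β) * (α · x) + - ((α · β) * (β · x))) ⊛ ′ α
    ⊖ ((α · α) * (β · x) + - ((α · β) * (α · x))) ⊛ ′ β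

  ⊥-component : V → V → V → V
  ⊥-component α β x = ⟪ component α β x ⟫

  ⊥-component-α : ∀ α β x → ⊥-component α β x · α ≡ 0#
  ⊥-component-α α β x = trans (·-linearˡ (component α β x) α)
    (solve 5 (λ A B P p q → (A :* B :- P :* P) :* p :- (B :* p :- P :* q) :* A :- (A :* q :- P :* p) :* P := :0)
      refl (α · α) (β · β) (α · β) (α · x) (β · x))

  ⊥-component-β : ∀ α β x → ⊥-component α β x · β ≡ 0#
  ⊥-component-β α β x = trans (·-linearˡ (component α β x) β)
    (trans (cong (λ r → gram α β * (β · x) + - (((β · β) * (α · x) + - ((α · β) * (β · x))) * r)
                        + - (((α · α) * (β · x) + - ((α · β) * (α · x))) * (β · β))) (·-comm β α))
    (solve 5 (λ A B P p q → (A :* B :- P :* P) :* q :- (B :* p :- P :* q) :* P :- (A :* q :- P :* p) :* B := :0)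
      refl (α · α) (β · β) (α · β) (α · x) (β · x)))

  -- The component π satisfies π·π = D(π·x), with D the Gram determinant, so π vanishes; dividing by
  -- D then writes x in terms of α and β.
  ⊥-component-zero : ∀ {α β} → 0# < gram α β → ∀ x → ⊥-component α β x · x ≡ 0# → Plane α β x
  ⊥-component-zero {α} {β} 0<D x πx≡0 = D ⁻¹ * p , D ⁻¹ * q , (begin
    x
      ≡⟨ combination-≡ (′ x) (1# ⊛ ′ x) (λ L → solve 1 (λ x → x := :1 :* x) refl (L x)) ⟩
    1# *ᵛ x
      ≡⟨ cong (_*ᵛ x) (*-inverseʳ D (0<⇒≢0 0<D)) ⟨
    (D * D ⁻¹) *ᵛ x
      ≡⟨ combination-≡ ((D * D ⁻¹) ⊛ ′ x)
           (D ⁻¹ ⊛ (D ⊛ ′ x ⊖ p ⊛ ′ α ⊖ q ⊛ ′ β) ⊕ ((D ⁻¹ * p) ⊛ ′ α ⊕ (D ⁻¹ * q) ⊛ ′ β))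
           (λ L → solve 7 (λ D i p q a b x → D :* i :* x
               := i :* (D :* x :- p :* a :- q :* b) :+ (i :* p :* a :+ i :* q :* b))
             refl D (D ⁻¹) p q (L α) (L β) (L x)) ⟩
    D ⁻¹ *ᵛ π +ᵛ ((D ⁻¹ * p) *ᵛ α +ᵛ (D ⁻¹ * q) *ᵛ β)
      ≡⟨ cong (λ z → D ⁻¹ *ᵛ z +ᵛ ((D ⁻¹ * p) *ᵛ α +ᵛ (D ⁻¹ * q) *ᵛ β)) π≡0 ⟩
    D ⁻¹ *ᵛ 0ᵛ +ᵛ ((D ⁻¹ * p) *ᵛ α +ᵛ (D ⁻¹ * q) *ᵛ β)
      ≡⟨ combination-≡ (D ⁻¹ ⊛ 𝟎 ⊕ ((D ⁻¹ * p) ⊛ ′ α ⊕ (D ⁻¹ * q) ⊛ ′ β))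
           ((D ⁻¹ * p) ⊛ ′ α ⊕ (D ⁻¹ * q) ⊛ ′ β)
           (λ L → solve 2 (λ i y → i :* :0 :+ y := y) refl (D ⁻¹) (D ⁻¹ * p * L α + D ⁻¹ * q * L β)) ⟩
    (D ⁻¹ * p) *ᵛ α +ᵛ (D ⁻¹ * q) *ᵛ β ∎)
    where
    open ≡-Reasoning
    D = gram α β
    p = (β · β) * (α · x) + - ((α · β) * (β · x))
    q = (α · α) * (β · x) + - ((α · β) * (α · x))
    π = ⊥-component α β x
    ππ≡0 : π · π ≡ 0#
    ππ≡0 = trans (·-linearʳ π (component α β x)) (trans
      (cong₂ (λ u v → D * (π · x) + - (p * u) + - (q * v)) (⊥-component-α α β x) (⊥-component-β α β x))
      (trans (cong (λ u → D * u + - (p * 0#) + - (q * 0#)) πx≡0)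
        (solve 3 (λ D p q → D :* :0 :- p :* :0 :- q :* :0 := :0) refl D p q)))
    π≡0 : π ≡ 0ᵛ
    π≡0 = [ (λ 0<ππ → ⊥-elim (0<⇒≢0 0<ππ ππ≡0)) , (λ π≡0 → π≡0) ]′ (·-definite π)

  record Generic (α β p : V) (γs : List V) : Set where
    field
      g       : V
      g·α≡0   : g · α ≡ 0#
      g·β≡0   : g · β ≡ 0#
      refines : Refines g p
      generic : ∀ {γ} → γ ∈ γs → Φ γ → g · γ ≡ 0# → Plane α β γ

  -- Each x in the list breaks the ties of the current functional by its own component orthogonal to
  -- the plane, so a zero at x forces x into the plane. Vectors already treated stay treated,
  -- because refining only shrinks the set of roots that are zeros.
  generic-functional : ∀ {α β} → 0# < gram α β → ∀ p → p · α ≡ 0# → p · β ≡ 0# →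
    ∀ γs → Generic α β p γs
  generic-functional 0<D p pα≡0 pβ≡0 [] = record
    { g = p ; g·α≡0 = pα≡0 ; g·β≡0 = pβ≡0 ; refines = λ _ 0<p → 0<p ; generic = λ () }
  generic-functional {α} {β} 0<D p pα≡0 pβ≡0 (x ∷ γs) =
    let v , v⊒g , v≡π = lexicographic g (⊥-component α β x) in record
    { g       = v
    ; g·α≡0   = trans (v≡π α g·α≡0) (⊥-component-α α β x)
    ; g·β≡0   = trans (v≡π β g·β≡0) (⊥-component-β α β x)
    ; refines = λ Φγ 0<p → v⊒g Φγ (refines Φγ 0<p)
    ; generic = λ
      { (here refl)  Φγ v≡0 → ⊥-component-zero {α} {β} 0<D x
          (trans (sym (v≡π x (refines-zero {v} {g} v⊒g Φγ v≡0))) v≡0)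
      ; (there γ∈γs) Φγ v≡0 → generic γ∈γs Φγ (refines-zero {v} {g} v⊒g Φγ v≡0) }
    }
    where open Generic (generic-functional {α} {β} 0<D p pα≡0 pβ≡0 γs)

  -- The hyperplane orthogonal to `e` supports the cone of f-positive roots and, once α is in it,
  -- contains no other f-positive root.
  Exposes : V → V → V → Set
  Exposes f e α = e · α ≡ 0# × (∀ {γ} → Φ γ → 0# < f · γ → γ ≢ α → 0# < e · γ)

  -- Ties of `g` are broken by b̂, a positive multiple of the component of β orthogonal to α. On a
  -- tied root aα + bβ this is b times the Gram determinant. Here b is positive: `separated`
  -- excludes a > 0 > b, the sign under c excludes b < 0 with a ≤ 0, and b = 0 leaves only α and -α.
  exposed : ∀ {α β} → Separated α β → ∀ {c g f} → 0# < c · α → 0# < c · β →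
    g · α ≡ 0# → (∀ {γ} → Φ γ → g · γ ≡ 0# → Plane α β γ) →
    Refines f g → (∀ γ → g · γ ≡ 0# → f · γ ≡ c · γ) →
    ∃ λ e → Exposes f e α
  exposed {α} {β} S {c} {g} {f} 0<cα 0<cβ gα≡0 generic f⊒g f≡c =
    let e , e⊒g , e≡b̂ = lexicographic g b̂ in
    e , trans (e≡b̂ α gα≡0) b̂α≡0 , λ {γ} Φγ 0<fγ γ≢α →
      [ e⊒g Φγ
      , (λ 0≡gγ → subst (0# <_) (sym (e≡b̂ γ (sym 0≡gγ)))
          (in-plane Φγ γ≢α (generic Φγ (sym 0≡gγ)) (subst (0# <_) (f≡c γ (sym 0≡gγ)) 0<fγ)))
      ]′ (refines-nonneg {f} {g} f⊒g Φγ 0<fγ)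
    where
    open Separated S
    A = α · α
    P = α · β
    b̂ = A *ᵛ β -ᵛ P *ᵛ α

    b̂α≡0 : b̂ · α ≡ 0#
    b̂α≡0 = trans (·-linearˡ (A ⊛ ′ β ⊖ P ⊛ ′ α) α)
      (solve 2 (λ A P → A :* P :- P :* A := :0) refl A P)

    b̂β≡D : b̂ · β ≡ gram α β
    b̂β≡D = trans (·-linearˡ (A ⊛ ′ β ⊖ P ⊛ ′ α) β)
      (cong (λ p → A * (β · β) + - (P * p)) (·-comm β α))

    in-plane : ∀ {γ} → Φ γ → γ ≢ α → Plane α β γ → 0# < c · γ → 0# < b̂ · γ
    in-plane {γ} Φγ γ≢α (a , b , γ≡) 0<cγ = cases (sign b)
      where
      b̂γ≡ : b * gram α β ≡ b̂ · γ
      b̂γ≡ = trans (solve 2 (λ a x → x := a :* :0 :+ x) refl a (b * gram α β))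
        (trans (cong₂ (λ x y → a * x + b * y) (sym b̂α≡0) (sym b̂β≡D))
          (trans (sym (·-linearʳ b̂ (a ⊛ ′ α ⊕ b ⊛ ′ β))) (cong (b̂ ·_) (sym γ≡))))

      cγ≡ : c · γ ≡ a * (c · α) + b * (c · β)
      cγ≡ = trans (cong (c ·_) γ≡) (·-linearʳ c (a ⊛ ′ α ⊕ b ⊛ ′ β))

      γ≢-α : γ ≢ -ᵛ α
      γ≢-α γ≡-α = pos∧neg 0<cα (inj₁ (subst (0# <_)
        (trans (cong (c ·_) γ≡-α) (·-linearʳ c (⊖ ′ α))) 0<cγ))

      cases : 0# < b ⊎ b ≡ 0# ⊎ 0# < - b → 0# < b̂ · γ
      cases (inj₁ 0<b)        = subst (0# <_) b̂γ≡ (*-pos 0<b 0<gram)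
      cases (inj₂ (inj₁ b≡0)) = ⊥-elim ([ γ≢-α , γ≢α ]′ (parallel Φα Φγ (a ,
        trans γ≡ (trans (cong (λ t → a *ᵛ α +ᵛ t *ᵛ β) b≡0)
          (combination-≡ (a ⊛ ′ α ⊕ 0# ⊛ ′ β) (a ⊛ ′ α)
            (λ L → solve 2 (λ x y → x :+ :0 :* y := x) refl (a * L α) (L β)))))))
      cases (inj₂ (inj₂ b<0)) =
        [ (λ 0<a → ⊥-elim (separated {α} {β} {a} {(- b)} S 0<a b<0 (subst Φ
            (trans γ≡ (combination-≡ (a ⊛ ′ α ⊕ b ⊛ ′ β) (a ⊛ ′ α ⊖ (- b) ⊛ ′ β)
              (λ L → solve 3 (λ x b y → x :+ b :* y := x :- :- b :* y) refl (a * L α) b (L β)))) Φγ)))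
        , (λ a≤0 → ⊥-elim (pos∧neg 0<cγ (subst (0# ≤_)
            (trans (solve 4 (λ a b x y → :- a :* x :+ :- b :* y := :- (a :* x :+ b :* y)) refl a b (c · α) (c · β))
              (cong -_ (sym cγ≡)))
            (+-nonneg (*-nonneg a≤0 (inj₁ 0<cα)) (inj₁ (*-pos b<0 0<cβ))))))
        ]′ (pos⊎nonpos a)

  -- `c-nonpos` is stated without reference to simple systems; its two obtuseness premises are later
  -- supplied by the simple roots of `f`.
  record Exposing (c α β : V) : Set where
    field
      f         : V
      regular   : ∀ {γ} → Φ γ → f · γ ≢ 0#
      0<fα      : 0# < f · α
      0<fβ      : 0# < f · β
      exposes-α : ∃ λ e → Exposes f e α
      exposes-β : ∃ λ e → Exposes f e β
      c-nonpos  : ∀ {δ} → Φ δ → 0# < f · δ → 0# ≤ - (α · δ) → 0# ≤ - (β · δ) → 0# ≤ - (c · δ)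

  exposing : ∀ {α β} → Separated α β → ∀ {c} → (∀ {γ} → Φ γ → c · γ ≢ 0#) →
    0# < c · α → 0# < c · β → Exposing c α β
  exposing {α} {β} S {c} c-regular 0<cα 0<cβ =
    let f , f⊒g , f≡c = lexicographic g c in record
    { f         = f
    ; regular   = λ {γ} Φγ f≡0 →
        c-regular Φγ (trans (sym (f≡c γ (refines-zero {f} {g} f⊒g Φγ f≡0))) f≡0)
    ; 0<fα      = subst (0# <_) (sym (f≡c α g·α≡0)) 0<cα
    ; 0<fβ      = subst (0# <_) (sym (f≡c β g·β≡0)) 0<cβ
    ; exposes-α = exposed {α} {β} S {c} {g} {f} 0<cα 0<cβ g·α≡0 plane f⊒g f≡c
    ; exposes-β = exposed {β} {α} (separated-swap S) {c} {g} {f} 0<cβ 0<cα g·β≡0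
        (λ {γ} Φγ g≡0 → let a , b , γ≡ = plane Φγ g≡0 in b , a , trans γ≡
          (combination-≡ (a ⊛ ′ α ⊕ b ⊛ ′ β) (b ⊛ ′ β ⊕ a ⊛ ′ α)
            (λ L → solve 2 (λ x y → x :+ y := y :+ x) refl (a * L α) (b * L β))))
        f⊒g f≡c
    ; c-nonpos  = λ {δ} Φδ 0<fδ αδ≤0 βδ≤0 → nonpos δ αδ≤0 βδ≤0
        (refines-nonneg {f} {p} (λ Φγ 0<p → f⊒g Φγ (refines Φγ 0<p)) Φδ 0<fδ)
    }
    where
    open Separated S
    A = α · α
    B = β · β
    P = α · β
    p = -ᵛ ⊥-component α β c

    p-orthogonal : ∀ γ → ⊥-component α β c · γ ≡ 0# → p · γ ≡ 0#
    p-orthogonal γ π≡0 = trans (·-linearˡ (⊖ ′ ⊥-component α β c) γ)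
      (trans (cong -_ (trans (·-comm γ (⊥-component α β c)) π≡0)) (solve 0 (:- :0 := :0) refl))

    γs = proj₁ (finite)
    open Generic (generic-functional {α} {β} 0<gram p
      (p-orthogonal α (⊥-component-α α β c)) (p-orthogonal β (⊥-component-β α β c)) γs)

    plane : ∀ {γ} → Φ γ → g · γ ≡ 0# → Plane α β γ
    plane Φγ = generic (proj₁ (proj₂ finite) Φγ) Φγ

    coordinate-nonneg : ∀ {x y z} → 0# < x → 0# < y → 0# < z → 0# ≤ x * y + - (P * z)
    coordinate-nonneg {x} {y} {z} 0<x 0<y 0<z = subst (0# ≤_)
      (solve 3 (λ w P z → w :+ :- P :* z := w :- P :* z) refl (x * y) P z)
      (+-nonneg (inj₁ (*-pos 0<x 0<y)) (*-nonneg obtuse (inj₁ 0<z)))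

    0<αc : 0# < α · c
    0<αc = subst (0# <_) (·-comm c α) 0<cα
    0<βc : 0# < β · c
    0<βc = subst (0# <_) (·-comm c β) 0<cβ

    nonpos : ∀ δ → 0# ≤ - (α · δ) → 0# ≤ - (β · δ) → 0# ≤ p · δ → 0# ≤ - (c · δ)
    -- By construction Dc + p = uα + vβ, and u, v are nonnegative because α·β ≤ 0.
    nonpos δ αδ≤0 βδ≤0 0≤pδ = *-cancelˡ-nonneg 0<gram (subst (0# ≤_) (begin
      p · δ + u * - (α · δ) + v * - (β · δ)
        ≡⟨ cong (λ x → x + u * - (α · δ) + v * - (β · δ)) (·-linearˡ (⊖ component α β c) δ) ⟩
      - (D * (δ · c) + - (u * (δ · α)) + - (v * (δ · β))) + u * - (α · δ) + v * - (β · δ)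
        ≡⟨ cong₂ (λ x y → - (D * (δ · c) + - (u * x) + - (v * y)) + u * - (α · δ) + v * - (β · δ))
             (·-comm δ α) (·-comm δ β) ⟩
      - (D * (δ · c) + - (u * (α · δ)) + - (v * (β · δ))) + u * - (α · δ) + v * - (β · δ)
        ≡⟨ solve 6 (λ D x u a v b → :- (D :* x :- u :* a :- v :* b) :+ u :* :- a :+ v :* :- b := D :* :- x)
             refl D (δ · c) u (α · δ) v (β · δ) ⟩
      D * - (δ · c)
        ≡⟨ cong (λ x → D * - x) (·-comm δ c) ⟩
      D * - (c · δ) ∎)
      (+-nonneg (+-nonneg 0≤pδ (*-nonneg (coordinate-nonneg (root-norm Φβ) 0<αc 0<βc) αδ≤0))
        (*-nonneg (coordinate-nonneg (root-norm Φα) 0<βc 0<αc) βδ≤0)))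
      where
      open ≡-Reasoning
      D = gram α β
      u = B * (α · c) + - (P * (β · c))
      v = A * (β · c) + - (P * (α · c))

-- Finitely generated nonnegative combinations.

module Cones (R : Reals) (n : ℕ) where
  open RootSystems R n
  open RealArithmetic R
  open RealOrder R
  open Linear R n

  infix 4 _≟ᵛ_
  _≟ᵛ_ : DecidableEquality V
  _≟ᵛ_ = Vec.≡-dec (IsStrictTotalOrder._≟_ isStrictTotalOrder)

  cone-rec : ∀ {S} (P : V → Set) → P 0ᵛ →
    (∀ {t v x} → 0# ≤ t → S v → P x → P (t *ᵛ v +ᵛ x)) → ∀ {x} → cone S x → P x
  cone-rec {S} P P0 P∷ (tvs , nonneg , refl) = go tvs nonneg
    where
    go : ∀ tvs → All (λ (t , v) → 0# ≤ t × S v) tvs → P (lincomb tvs)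
    go []              []                      = P0
    go ((t , v) ∷ tvs) ((0≤t , Sv) ∷ nonneg) = P∷ 0≤t Sv (go tvs nonneg)

  cone-0 : ∀ {S} → cone S 0ᵛ
  cone-0 = [] , [] , refl

  cone-∷ : ∀ {S t v x} → 0# ≤ t → S v → cone S x → cone S (t *ᵛ v +ᵛ x)
  cone-∷ {S} {t} {v} 0≤t Sv (tvs , nonneg , x≡) =
    (t , v) ∷ tvs , (0≤t , Sv) ∷ nonneg , cong (t *ᵛ v +ᵛ_) x≡

  cone-⊇ : ∀ {S v} → S v → cone S v
  cone-⊇ {S} {v} Sv = subst (cone S)
    (combination-≡ (1# ⊛ ′ v ⊕ 𝟎) (′ v) (λ L → solve 1 (λ x → :1 :* x :+ :0 := x) refl (L v)))
    (cone-∷ (inj₁ 0<1) Sv cone-0)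

  cone-+ : ∀ {S x y} → cone S x → cone S y → cone S (x +ᵛ y)
  cone-+ {S} {x} {y} Cx Cy = cone-rec (λ z → cone S (z +ᵛ y))
    (subst (cone S) (combination-≡ (′ y) (𝟎 ⊕ ′ y) (λ L → solve 1 (λ y → y := :0 :+ y) refl (L y))) Cy)
    (λ {t} {v} {z} 0≤t Sv Czy → subst (cone S)
      (combination-≡ (t ⊛ ′ v ⊕ (′ z ⊕ ′ y)) ((t ⊛ ′ v ⊕ ′ z) ⊕ ′ y)
        (λ L → solve 3 (λ v z y → v :+ (z :+ y) := v :+ z :+ y) refl (t * L v) (L z) (L y)))
      (cone-∷ 0≤t Sv Czy)) Cx

  cone-* : ∀ {S x r} → 0# ≤ r → cone S x → cone S (r *ᵛ x)
  cone-* {S} {x} {r} 0≤r = cone-rec (λ z → cone S (r *ᵛ z))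
    (subst (cone S) (combination-≡ 𝟎 (r ⊛ 𝟎) (λ L → solve 1 (λ r → :0 := r :* :0) refl r)) cone-0)
    (λ {t} {v} {z} 0≤t Sv Crz → subst (cone S)
      (combination-≡ ((r * t) ⊛ ′ v ⊕ r ⊛ ′ z) (r ⊛ (t ⊛ ′ v ⊕ ′ z))
        (λ L → solve 4 (λ r t v z → r :* t :* v :+ r :* z := r :* (t :* v :+ z)) refl r t (L v) (L z)))
      (cone-∷ (*-nonneg 0≤r 0≤t) Sv Crz))

  cone-bind : ∀ {S T x} → (∀ {v} → S v → cone T v) → cone S x → cone T x
  cone-bind {S} {T} S⊆T = cone-rec (cone T) cone-0
    (λ 0≤t Sv Cx → cone-+ (cone-* 0≤t (S⊆T Sv)) Cx)

  -- `S` itself cannot be searched; a generator satisfying `Q` is instead read off the finite list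
  -- that presents the given point.
  cone-positive : ∀ {S L} → IsLinear L → (Q : V → Set) → (∀ {v} → S v → Q v ⊎ 0# < L v) →
    ∀ {x} → cone S x → (∃ λ v → S v × Q v) ⊎ 0# < L x ⊎ x ≡ 0ᵛ
  cone-positive {S} {L} isLinear Q Q⊎pos = cone-rec P (inj₂ (inj₂ refl))
    (λ {t} {v} {x} 0≤t Sv → step 0≤t Sv (Q⊎pos Sv))
    where
    P : V → Set
    P x = (∃ λ v → S v × Q v) ⊎ 0# < L x ⊎ x ≡ 0ᵛ

    step : ∀ {t v x} → 0# ≤ t → S v → Q v ⊎ 0# < L v → P x → P (t *ᵛ v +ᵛ x)
    step _ Sv (inj₁ Qv) _ = inj₁ (_ , Sv , Qv)
    step _ _ _ (inj₁ found) = inj₁ found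
    step {t} {v} {x} (inj₁ 0<t) Sv (inj₂ 0<v) (inj₂ 0≤x) =
      inj₂ (inj₁ (subst (0# <_) (sym (apply-correct isLinear (t ⊛ ′ v ⊕ ′ x)))
        (+-pos-nonneg (*-pos 0<t 0<v) ([ inj₁ , (λ x≡0 → inj₂ (sym (trans (cong L x≡0) (apply-correct isLinear 𝟎)))) ]′ 0≤x))))
    step {t} {v} {x} (inj₂ 0≡t) Sv (inj₂ 0<v) (inj₂ 0≤x) = subst P
      (trans (combination-≡ (′ x) (0# ⊛ ′ v ⊕ ′ x) (λ L → solve 2 (λ v x → x := :0 :* v :+ x) refl (L v) (L x)))
        (cong (λ r → r *ᵛ v +ᵛ x) 0≡t)) (inj₂ 0≤x)

  _∖_ : Subset → V → Subset
  (S ∖ δ) v = S v × v ≢ δ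

  cone-split : ∀ {S} δ {x} → cone S x → ∃₂ λ a x′ → 0# ≤ a × cone (S ∖ δ) x′ × x ≡ a *ᵛ δ +ᵛ x′
  cone-split {S} δ = cone-rec P
    (0# , 0ᵛ , inj₂ refl , cone-0 ,
      combination-≡ 𝟎 (0# ⊛ ′ δ ⊕ 𝟎) (λ L → solve 1 (λ d → :0 := :0 :* d :+ :0) refl (L δ)))
    step
    where
    P : V → Set
    P x = ∃₂ λ a x′ → 0# ≤ a × cone (S ∖ δ) x′ × x ≡ a *ᵛ δ +ᵛ x′
    step : ∀ {t v x} → 0# ≤ t → S v → P x → P (t *ᵛ v +ᵛ x)
    step {t} {v} {x} 0≤t Sv (a , x′ , 0≤a , Cx′ , x≡) with v ≟ᵛ δ
    ... | yes v≡δ = t + a , x′ , +-nonneg 0≤t 0≤a , Cx′ ,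
      trans (cong₂ (λ v x → t *ᵛ v +ᵛ x) v≡δ x≡)
        (combination-≡ (t ⊛ ′ δ ⊕ (a ⊛ ′ δ ⊕ ′ x′)) ((t + a) ⊛ ′ δ ⊕ ′ x′)
          (λ L → solve 4 (λ t a d x → t :* d :+ (a :* d :+ x) := (t :+ a) :* d :+ x) refl t a (L δ) (L x′)))
    ... | no v≢δ = a , t *ᵛ v +ᵛ x′ , 0≤a , cone-∷ 0≤t (Sv , v≢δ) Cx′ ,
      trans (cong (λ x → t *ᵛ v +ᵛ x) x≡)
        (combination-≡ (t ⊛ ′ v ⊕ (a ⊛ ′ δ ⊕ ′ x′)) (a ⊛ ′ δ ⊕ (t ⊛ ′ v ⊕ ′ x′))
          (λ L → solve 3 (λ v d x → v :+ (d :+ x) := d :+ (v :+ x)) refl (t * L v) (a * L δ) (L x′)))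

-- Simple roots: extremality, obtuseness and the effect of simple reflections.

module SimpleRoots (R : Reals) (n : ℕ) {Φ Φ⁺ Δ : RootSystems.Subset R n}
  (isRootSystem : RootSystems.IsRootSystem R n Φ)
  (crystallographic : RootSystems.Crystallographic R n Φ)
  (isPositiveSystem : RootSystems.IsPositiveSystem R n Φ Φ⁺)
  (isSimpleSystem : RootSystems.IsSimpleSystem R n Φ⁺ Δ) where
  open RootSystems R n
  open RealArithmetic R
  open RealOrder R
  open Linear R n
  open Reflections R n
  open CrystallographicRoots R n isRootSystem crystallographic
  open SeparatedRoots R n isRootSystem crystallographic
  open Cones R n
  open IsSimpleSystem isSimpleSystem

  c : V
  c = proj₁ isPositiveSystem

  regular : ∀ {γ} → Φ γ → c · γ ≢ 0#
  regular = proj₁ (proj₂ isPositiveSystem)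

  Φ⁺≐ : Φ⁺ ≐ (Φ ∩ λ x → 0# < c · x)
  Φ⁺≐ = proj₂ (proj₂ isPositiveSystem)

  simple-root : ∀ {δ} → Δ δ → Φ δ
  simple-root = proj₁ ∘ proj₁ Φ⁺≐ ∘ Δ⊆Φ⁺

  simple-positive : ∀ {δ} → Δ δ → 0# < c · δ
  simple-positive = proj₂ ∘ proj₁ Φ⁺≐ ∘ Δ⊆Φ⁺

  positive-cone : ∀ {γ} → Φ γ → 0# < c · γ → cone Δ γ
  positive-cone Φγ 0<cγ = proj₂ generates (cone-⊇ (proj₂ Φ⁺≐ (Φγ , 0<cγ)))

  ·-neg : ∀ x y → x · (-ᵛ y) ≡ - (x · y)
  ·-neg x y = ·-linearʳ x (⊖ ′ y)

  positive⊎negative : ∀ {γ} → Φ γ → 0# < c · γ ⊎ Φ (-ᵛ γ) × 0# < c · (-ᵛ γ)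
  positive⊎negative {γ} Φγ =
    [ inj₁ , [ (λ cγ≡0 → ⊥-elim (regular Φγ cγ≡0))
             , (λ cγ<0 → inj₂ (root-neg Φγ , subst (0# <_) (sym (·-neg c γ)) cγ<0)) ]′ ]′
    (sign (c · γ))

  positive⇒≢neg : ∀ {γ δ} → 0# < c · γ → 0# < c · δ → γ ≢ -ᵛ δ
  positive⇒≢neg {γ} {δ} 0<cγ 0<cδ γ≡-δ =
    pos∧neg 0<cδ (inj₁ (subst (0# <_) (trans (cong (c ·_) γ≡-δ) (·-neg c δ)) 0<cγ))

  parallel-positive : ∀ {γ δ} → Φ γ → Φ δ → 0# < c · γ → 0# < c · δ → Line δ γ → γ ≡ δ
  parallel-positive Φγ Φδ 0<cγ 0<cδ γ∥δ =
    [ (λ γ≡-δ → ⊥-elim (positive⇒≢neg 0<cγ 0<cδ γ≡-δ)) , (λ γ≡δ → γ≡δ) ]′ (parallel Φδ Φγ γ∥δ)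

  -- Otherwise the remaining simple roots would still generate the cone, against minimality.
  simple-indispensable : ∀ {δ} → Δ δ → ¬ cone (Δ ∖ δ) δ
  simple-indispensable {δ} Δδ Cδ = proj₂ (minimal {Δ ∖ δ} proj₁ (forward , backward) Δδ) refl
    where
    forward : cone (Δ ∖ δ) ⊆ cone Φ⁺
    forward = cone-bind (cone-⊇ ∘ Δ⊆Φ⁺ ∘ proj₁)
    replace : ∀ {v} → Δ v → cone (Δ ∖ δ) v
    replace {v} Δv with v ≟ᵛ δ
    ... | yes refl = Cδ
    ... | no v≢δ   = cone-⊇ (Δv , v≢δ)
    backward : cone Φ⁺ ⊆ cone (Δ ∖ δ)
    backward = cone-bind replace ∘ proj₂ generates

  cone-nonneg : ∀ {δ x} → cone (Δ ∖ δ) x → 0# < c · x ⊎ x ≡ 0ᵛ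
  cone-nonneg Cx = [ (λ ()) ∘ proj₂ ∘ proj₂ , (λ 0≤x → 0≤x) ]′
    (cone-positive (·-isLinear c) (λ _ → ⊥) (inj₂ ∘ simple-positive ∘ proj₁) Cx)

  -- δ spans an extreme ray. Splitting multiples of δ off x and y leaves tδ = x′ + y′ with x′ and y′
  -- generated by the other simple roots. If t > 0, then δ is redundant; if t ≤ 0, then x′ = 0
  -- because c is positive at nonzero points of the cone.
  simple-extremal : ∀ {δ x y r} → Δ δ → cone Δ x → cone Δ y → x +ᵛ y ≡ r *ᵛ δ → Line δ x
  simple-extremal {δ} {x} {y} {r} Δδ Cx Cy x+y≡ =
    let a , x′ , 0≤a , Cx′ , x≡ = cone-split δ Cx
        b , y′ , 0≤b , Cy′ , y≡ = cone-split δ Cy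
        t = r + - (a + b)
        tδ≡ : t *ᵛ δ ≡ x′ +ᵛ y′
        tδ≡ = begin
          t *ᵛ δ
            ≡⟨ combination-≡ (t ⊛ ′ δ) (r ⊛ ′ δ ⊖ (a + b) ⊛ ′ δ)
                 (λ L → solve 3 (λ r s d → (r :- s) :* d := r :* d :- s :* d) refl r (a + b) (L δ)) ⟩
          r *ᵛ δ -ᵛ (a + b) *ᵛ δ
            ≡⟨ cong (λ z → z -ᵛ (a + b) *ᵛ δ) (trans (sym x+y≡) (cong₂ _+ᵛ_ x≡ y≡)) ⟩
          (a *ᵛ δ +ᵛ x′ +ᵛ (b *ᵛ δ +ᵛ y′)) -ᵛ (a + b) *ᵛ δ
            ≡⟨ combination-≡ ((a ⊛ ′ δ ⊕ ′ x′ ⊕ (b ⊛ ′ δ ⊕ ′ y′)) ⊖ (a + b) ⊛ ′ δ) (′ x′ ⊕ ′ y′)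
                 (λ L → solve 5 (λ a b d x y → a :* d :+ x :+ (b :* d :+ y) :- (a :+ b) :* d := x :+ y)
                   refl a b (L δ) (L x′) (L y′)) ⟩
          x′ +ᵛ y′ ∎
    in [ (λ 0<t → ⊥-elim (simple-indispensable Δδ (subst (cone (Δ ∖ δ)) (begin
             t ⁻¹ *ᵛ (x′ +ᵛ y′)
               ≡⟨ cong (t ⁻¹ *ᵛ_) tδ≡ ⟨
             t ⁻¹ *ᵛ (t *ᵛ δ)
               ≡⟨ combination-≡ (t ⁻¹ ⊛ t ⊛ ′ δ) ((t * t ⁻¹) ⊛ ′ δ)
                    (λ L → solve 3 (λ i t d → i :* (t :* d) := t :* i :* d) refl (t ⁻¹) t (L δ)) ⟩
             (t * t ⁻¹) *ᵛ δ
               ≡⟨ cong (_*ᵛ δ) (*-inverseʳ t (0<⇒≢0 0<t)) ⟩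
             1# *ᵛ δ
               ≡⟨ combination-≡ (1# ⊛ ′ δ) (′ δ) (λ L → solve 1 (λ d → :1 :* d := d) refl (L δ)) ⟩
             δ ∎)
             (cone-* (inj₁ (⁻¹-pos 0<t)) (cone-+ Cx′ Cy′)))))
       , (λ t≤0 → [ (λ 0<cx′ → ⊥-elim (pos∧neg
             (+-pos-nonneg 0<cx′ ([ inj₁ , (λ y′≡0 → inj₂ (sym (trans (cong (c ·_) y′≡0) (·-linearʳ c 𝟎)))) ]′
               (cone-nonneg Cy′)))
             (subst (0# ≤_)
               (trans (solve 2 (λ t d → :- t :* d := :- (t :* d)) refl t (c · δ))
                 (cong -_ (trans (sym (·-linearʳ c (t ⊛ ′ δ)))
                   (trans (cong (c ·_) tδ≡) (·-linearʳ c (′ x′ ⊕ ′ y′))))))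
               (*-nonneg t≤0 (inj₁ (simple-positive Δδ))))))
           , (λ x′≡0 → a , trans x≡ (trans (cong (a *ᵛ δ +ᵛ_) x′≡0)
               (combination-≡ (a ⊛ ′ δ ⊕ 𝟎) (a ⊛ ′ δ)
                 (λ L → solve 1 (λ d → d :+ :0 := d) refl (a * L δ)))))
           ]′ (cone-nonneg Cx′))
       ]′ (pos⊎nonpos t)
    where open ≡-Reasoning

  -- If the negative of `s δ γ` were positive, its sum with γ would be a multiple of δ, and
  -- extremality would make γ proportional to δ.
  s-positive : ∀ {δ γ} → Δ δ → Φ γ → 0# < c · γ → γ ≢ δ → 0# < c · s δ γ
  s-positive {δ} {γ} Δδ Φγ 0<cγ γ≢δ =
    [ (λ 0<csγ → 0<csγ)
    , (λ (Φ-sγ , 0<c-sγ) → ⊥-elim (γ≢δ (parallel-positive Φγ (simple-root Δδ) 0<cγ (simple-positive Δδ)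
        (simple-extremal {r = coefficient δ γ} Δδ (positive-cone Φγ 0<cγ) (positive-cone Φ-sγ 0<c-sγ)
          (combination-≡ (′ γ ⊕ ⊖ (′ γ ⊖ coefficient δ γ ⊛ ′ δ)) (coefficient δ γ ⊛ ′ δ)
            (λ L → solve 2 (λ g d → g :+ :- (g :- d) := d) refl (L γ) (coefficient δ γ * L δ)))))))
    ]′ (positive⊎negative (root-s (simple-root Δδ) Φγ))

  difference-not-positive : ∀ {δ ε} → Δ δ → Δ ε → δ ≢ ε → Φ (δ -ᵛ ε) → ¬ 0# < c · (δ -ᵛ ε)
  difference-not-positive {δ} {ε} Δδ Δε δ≢ε Φδ-ε 0<cδ-ε =
    δ≢ε (sym (parallel-positive (simple-root Δε) (simple-root Δδ) (simple-positive Δε) (simple-positive Δδ)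
      (simple-extremal {r = 1#} Δδ (cone-⊇ Δε) (positive-cone Φδ-ε 0<cδ-ε)
        (combination-≡ (′ ε ⊕ (′ δ ⊖ ′ ε)) (1# ⊛ ′ δ)
          (λ L → solve 2 (λ d e → e :+ (d :- e) := :1 :* d) refl (L δ) (L ε))))))

  simple-obtuse : ∀ {δ ε} → Δ δ → Δ ε → δ ≢ ε → 0# ≤ - (δ · ε)
  simple-obtuse {δ} {ε} Δδ Δε δ≢ε = [ ⊥-elim ∘ not-acute , (λ δε≤0 → δε≤0) ]′ (pos⊎nonpos (δ · ε))
    where
    negate : -ᵛ (δ -ᵛ ε) ≡ ε -ᵛ δ
    negate = combination-≡ (⊖ (′ δ ⊖ ′ ε)) (′ ε ⊖ ′ δ)
      (λ L → solve 2 (λ d e → :- (d :- e) := e :- d) refl (L δ) (L ε))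
    not-acute : ¬ 0# < δ · ε
    not-acute 0<δε =
      let Φδ-ε = acute-difference (simple-root Δδ) (simple-root Δε) δ≢ε 0<δε in
      [ difference-not-positive Δδ Δε δ≢ε Φδ-ε
      , (λ (Φε-δ , 0<cε-δ) → difference-not-positive Δε Δδ (δ≢ε ∘ sym)
          (subst Φ negate Φε-δ) (subst (λ x → 0# < c · x) negate 0<cε-δ))
      ]′ (positive⊎negative Φδ-ε)

  incomparable⇒separated : ∀ {α β} → Φ⁺ α → Φ⁺ β → Incomparable Φ⁺ α β → Separated α β
  incomparable⇒separated {α} {β} Φ⁺α Φ⁺β (¬α-β , ¬β-α) = record
    { Φα = Φα ; Φβ = Φβ ; obtuse = obtuse ; 0<gram = 0<gram ; no-difference = no-difference }
    where
    Φα = proj₁ (proj₁ Φ⁺≐ Φ⁺α)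
    Φβ = proj₁ (proj₁ Φ⁺≐ Φ⁺β)

    α≢β : α ≢ β
    α≢β α≡β = ¬α-β (subst (cone Φ⁺) (trans
      (combination-≡ 𝟎 (′ α ⊖ ′ α) (λ L → solve 1 (λ a → :0 := a :- a) refl (L α)))
      (cong (λ x → α -ᵛ x) α≡β)) cone-0)

    unscale : ∀ {t x y} → 0# < t → Φ (t *ᵛ x -ᵛ t *ᵛ y) → 0# < c · (t *ᵛ x -ᵛ t *ᵛ y) → cone Φ⁺ (x -ᵛ y)
    unscale {t} {x} {y} 0<t Φt 0<ct = subst (cone Φ⁺)
      (trans (combination-≡ (t ⁻¹ ⊛ (t ⊛ ′ x ⊖ t ⊛ ′ y)) ((t * t ⁻¹) ⊛ (′ x ⊖ ′ y))
          (λ L → solve 4 (λ i t x y → i :* (t :* x :- t :* y) := t :* i :* (x :- y)) refl (t ⁻¹) t (L x) (L y)))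
        (trans (cong (_*ᵛ (x -ᵛ y)) (*-inverseʳ t (0<⇒≢0 0<t)))
          (combination-≡ (1# ⊛ (′ x ⊖ ′ y)) (′ x ⊖ ′ y)
            (λ L → solve 1 (λ x → :1 :* x := x) refl (L x + - L y)))))
      (cone-* (inj₁ (⁻¹-pos 0<t)) (cone-⊇ (proj₂ Φ⁺≐ (Φt , 0<ct))))

    no-difference : ∀ t → 0# < t → ¬ Φ (t *ᵛ α -ᵛ t *ᵛ β)
    no-difference t 0<t Φt =
      [ (λ 0<ct → ¬α-β (unscale 0<t Φt 0<ct))
      , (λ (Φ-t , 0<c-t) → ¬β-α (unscale {t} {β} {α} 0<t
          (root-swap {t} {t} {α} {β} Φt) (subst (λ x → 0# < c · x) (sym (swap-combination t t α β)) 0<c-t)))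
      ]′ (positive⊎negative Φt)

    obtuse : 0# ≤ - (α · β)
    obtuse =
      [ (λ 0<αβ → ⊥-elim (no-difference 1# 0<1 (subst Φ
          (combination-≡ (′ α ⊖ ′ β) (1# ⊛ ′ α ⊖ 1# ⊛ ′ β)
            (λ L → solve 2 (λ a b → a :- b := :1 :* a :- :1 :* b) refl (L α) (L β)))
          (acute-difference Φα Φβ α≢β 0<αβ))))
      , (λ αβ≤0 → αβ≤0)
      ]′ (pos⊎nonpos (α · β))

    0<gram : 0# < gram α β
    0<gram = [ (λ 0<D → 0<D)
      , [ (λ β≡-α → ⊥-elim (positive⇒≢neg (proj₂ (proj₁ Φ⁺≐ Φ⁺β)) (proj₂ (proj₁ Φ⁺≐ Φ⁺α)) β≡-α))
        , (λ β≡α → ⊥-elim (α≢β (sym β≡α))) ]′ ]′ (cauchy-schwarz Φα Φβ)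

-- Carrying the simple system of c to that of f by the Weyl group.

module Transitivity (R : Reals) (n : ℕ) {Φ Φ⁺ Δ : RootSystems.Subset R n}
  (isRootSystem : RootSystems.IsRootSystem R n Φ)
  (crystallographic : RootSystems.Crystallographic R n Φ)
  (isPositiveSystem : RootSystems.IsPositiveSystem R n Φ Φ⁺)
  (isSimpleSystem : RootSystems.IsSimpleSystem R n Φ⁺ Δ) where
  open RootSystems R n
  open RealArithmetic R
  open RealOrder R
  open Linear R n
  open Reflections R n
  open CrystallographicRoots R n isRootSystem crystallographic
  open Functionals R n isRootSystem crystallographic
  open Cones R n
  open SimpleRoots R n isRootSystem crystallographic isPositiveSystem isSimpleSystem
  open IsRootSystem isRootSystem using (finite; nonzero)

  -- The properties used of w are carried along as it is built from the identity and reflections, so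
  -- none has to be extracted from a derivation of `Weyl Φ w`.
  record WeylElement : Set where
    field
      w w⁻¹    : V → V
      weyl     : Weyl Φ w
      inverseˡ : ∀ x → w⁻¹ (w x) ≡ x
      inverseʳ : ∀ x → w (w⁻¹ x) ≡ x
      w-+      : ∀ x y → w (x +ᵛ y) ≡ w x +ᵛ w y
      w-*      : ∀ t x → w (t *ᵛ x) ≡ t *ᵛ w x
      isometry : ∀ x y → w x · w y ≡ x · y
      w-root   : ∀ {γ} → Φ γ → Φ (w γ)
      w⁻¹-root : ∀ {γ} → Φ γ → Φ (w⁻¹ γ)

    w-neg : ∀ x → w (-ᵛ x) ≡ -ᵛ w x
    w-neg x = trans (cong w (-ᵛ≡-1*ᵛ x)) (trans (w-* (- 1#) x) (sym (-ᵛ≡-1*ᵛ (w x))))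

    w⁻¹-neg : ∀ x → w⁻¹ (-ᵛ x) ≡ -ᵛ w⁻¹ x
    w⁻¹-neg x = trans (cong (λ y → w⁻¹ (-ᵛ y)) (sym (inverseʳ x)))
      (trans (cong w⁻¹ (sym (w-neg (w⁻¹ x)))) (inverseˡ (-ᵛ w⁻¹ x)))

    pullback : ∀ f → IsLinear (λ x → f · w x)
    pullback f = record
      { +-homo = λ x y → trans (cong (f ·_) (w-+ x y)) (·-linearʳ f (′ w x ⊕ ′ w y))
      ; *-homo = λ t x → trans (cong (f ·_) (w-* t x)) (·-linearʳ f (t ⊛ ′ w x)) }

  identityʷ : WeylElement
  identityʷ = record
    { w = id ; w⁻¹ = id ; weyl = identity ; inverseˡ = λ _ → refl ; inverseʳ = λ _ → refl
    ; w-+ = λ _ _ → refl ; w-* = λ _ _ → refl ; isometry = λ _ _ → refl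
    ; w-root = id ; w⁻¹-root = id }

  _∘s_ : WeylElement → ∀ {δ} → Φ δ → WeylElement
  _∘s_ E {δ} Φδ = record
    { w        = w ∘ s δ
    ; w⁻¹      = s δ ∘ w⁻¹
    ; weyl     = compose weyl (reflection Φδ)
    ; inverseˡ = λ x → trans (cong (s δ) (inverseˡ (s δ x))) (s-involutive δ 0<δ x)
    ; inverseʳ = λ x → trans (cong w (s-involutive δ 0<δ (w⁻¹ x))) (inverseʳ x)
    ; w-+      = λ x y → trans (cong w (s-+ δ x y)) (w-+ (s δ x) (s δ y))
    ; w-*      = λ t x → trans (cong w (s-* δ t x)) (w-* t (s δ x))
    ; isometry = λ x y → trans (isometry (s δ x) (s δ y)) (s-isometry δ 0<δ x y)
    ; w-root   = λ Φγ → w-root (root-s Φδ Φγ)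
    ; w⁻¹-root = λ Φγ → root-s Φδ (w⁻¹-root Φγ)
    }
    where
    open WeylElement E
    0<δ = root-norm Φδ

  module _ (f : V) (f-regular : ∀ {γ} → Φ γ → f · γ ≢ 0#) where

    -- Such a root is the image under w of a c-positive root and yet f-negative. Membership in `Φ`
    -- is left out to keep the predicate decidable.
    Inversion : WeylElement → V → Set
    Inversion E γ = 0# < c · WeylElement.w⁻¹ E γ × 0# < - (f · γ)

    inversion? : ∀ E γ → Dec (Inversion E γ)
    inversion? E γ = (0# <? c · WeylElement.w⁻¹ E γ) ×-dec (0# <? - (f · γ))
      where open IsStrictTotalOrder isStrictTotalOrder using (_<?_)

    -- The preimage of γ under w is a nonnegative combination of simple roots; were all their images
    -- f-positive, γ would be too.
    negative-simple-root : ∀ E {γ} → Φ γ → Inversion E γ →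
      ∃ λ δ → Δ δ × 0# < - (f · WeylElement.w E δ)
    negative-simple-root E {γ} Φγ (0<cγ , fγ<0) =
      [ id
      , [ (λ 0<fγ → ⊥-elim (pos∧neg fγ<0 (inj₁ (subst (0# <_)
            (trans (cong (f ·_) (inverseʳ γ)) (solve 1 (λ x → x := :- :- x) refl (f · γ))) 0<fγ))))
        , (λ w⁻¹γ≡0 → ⊥-elim (nonzero (w⁻¹-root Φγ) w⁻¹γ≡0)) ]′
      ]′ (cone-positive (pullback f) (λ δ → 0# < - (f · w δ)) sign-of
           (positive-cone (w⁻¹-root Φγ) 0<cγ))
      where
      open WeylElement E
      sign-of : ∀ {δ} → Δ δ → 0# < - (f · w δ) ⊎ 0# < f · w δ
      sign-of {δ} Δδ = [ inj₂ , [ (λ f≡0 → ⊥-elim (f-regular (w-root (simple-root Δδ)) f≡0)) , inj₁ ]′ ]′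
        (sign (f · w δ))

    -- The reflection in δ preserves the c-sign of every root except δ and -δ, so only wδ and -wδ
    -- can change status: wδ ceases to be an inversion, and -wδ is f-positive.
    inversion-∘s : ∀ E {δ} (Δδ : Δ δ) → 0# < - (f · WeylElement.w E δ) → ∀ {γ} → Φ γ →
      Inversion (E ∘s simple-root Δδ) γ → Inversion E γ × γ ≢ WeylElement.w E δ
    inversion-∘s E {δ} Δδ fwδ<0 {γ} Φγ (0<csη , fγ<0) = (0<cη , fγ<0) , γ≢wδ
      where
      open WeylElement E
      η = w⁻¹ γ
      0<δ = root-norm (simple-root Δδ)

      γ≢wδ : γ ≢ w δ
      γ≢wδ γ≡wδ = pos∧neg (simple-positive Δδ) (inj₁ (subst (0# <_)
        (trans (cong (λ x → c · s δ x) (trans (cong w⁻¹ γ≡wδ) (inverseˡ δ)))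
          (trans (cong (c ·_) (s-self δ 0<δ)) (·-neg c δ))) 0<csη))

      -η≢δ : -ᵛ η ≢ δ
      -η≢δ -η≡δ = pos∧neg fwδ<0 (inj₁ (subst (0# <_) (begin
        - (f · γ)            ≡⟨ ·-neg f γ ⟨
        f · (-ᵛ γ)           ≡⟨ cong (λ x → f · (-ᵛ x)) (inverseʳ γ) ⟨
        f · (-ᵛ w η)         ≡⟨ cong (f ·_) (w-neg η) ⟨
        f · w (-ᵛ η)         ≡⟨ cong (λ x → f · w x) -η≡δ ⟩
        f · w δ              ≡⟨ solve 1 (λ x → x := :- :- x) refl (f · w δ) ⟩
        - - (f · w δ)        ∎) fγ<0))
        where open ≡-Reasoning

      s-neg : s δ (-ᵛ η) ≡ -ᵛ s δ η
      s-neg = trans (cong (s δ) (-ᵛ≡-1*ᵛ η)) (trans (s-* δ (- 1#) η) (sym (-ᵛ≡-1*ᵛ (s δ η))))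

      0<cη : 0# < c · η
      0<cη = [ id , (λ (Φ-η , 0<c-η) → ⊥-elim (pos∧neg 0<csη (inj₁ (subst (0# <_)
          (trans (cong (c ·_) s-neg) (·-neg c (s δ η))) (s-positive Δδ Φ-η 0<c-η -η≢δ))))) ]′
        (positive⊎negative (w⁻¹-root Φγ))

    -- The list need only contain the inversions, so they are never counted and repetitions are
    -- harmless. Deleting wδ shortens it, and the strict bound excludes k = 0.
    descend : ∀ k E (γs : List V) → length γs ℕ.< k → (∀ {γ} → Φ γ → Inversion E γ → γ ∈ γs) →
      ∃ λ E′ → ∀ {γ} → Φ γ → ¬ Inversion E′ γ
    descend (suc k) E γs bound inversions⊆ =
      search (any? (inversion? E) roots)
      where
      open WeylElement E using (w)
      roots = proj₁ finite

      search : Dec (Any.Any (Inversion E) roots) → ∃ λ E′ → ∀ {γ} → Φ γ → ¬ Inversion E′ γ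
      search (no ¬inv)  = E , λ Φγ inv → ¬inv (lose (proj₁ (proj₂ finite) Φγ) inv)
      search (yes inv∃) =
        let γ , γ∈ , inv  = find inv∃
            δ , Δδ , wδ<0 = negative-simple-root E (proj₂ (proj₂ finite) γ∈) inv
            keep? = λ x → ¬? (x ≟ᵛ w δ)
            wδ∈ = inversions⊆ (WeylElement.w-root E (simple-root Δδ))
                    (subst (λ x → 0# < c · x) (sym (WeylElement.inverseˡ E δ)) (simple-positive Δδ) , wδ<0)
        in descend k (E ∘s simple-root Δδ) (filter keep? γs)
             (ℕ.<-≤-trans (filter-notAll keep? γs (Any.map (λ wδ≡x ¬x≡wδ → ¬x≡wδ (sym wδ≡x)) wδ∈))
               (ℕ.≤-pred bound))
             (λ Φγ inv′ → let inv , γ≢wδ = inversion-∘s E Δδ wδ<0 Φγ inv′ in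
               ∈-filter⁺ keep? (inversions⊆ Φγ inv) γ≢wδ)

    -- One implication suffices: c and f are nonzero on roots, so the converse follows by passing to
    -- -γ.
    transitive : ∃ λ E → ∀ {γ} → Φ γ → 0# < c · WeylElement.w⁻¹ E γ → 0# < f · γ
    transitive =
      let E , no-inversion = descend (suc (length (proj₁ finite))) identityʷ (proj₁ finite) ℕ.≤-refl
            (λ Φγ _ → proj₁ (proj₂ finite) Φγ)
      in E , λ {γ} Φγ 0<cγ → [ id , [ (λ f≡0 → ⊥-elim (f-regular Φγ f≡0))
                                    , (λ f<0 → ⊥-elim (no-inversion Φγ (0<cγ , f<0))) ]′ ]′ (sign (f · γ))

  module _ (E : WeylElement) {f : V}
    (carries : ∀ {γ} → Φ γ → 0# < c · WeylElement.w⁻¹ E γ → 0# < f · γ) where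
    open WeylElement E

    simple-image-positive : ∀ {δ} → Δ δ → 0# < f · w δ
    simple-image-positive {δ} Δδ = carries (w-root (simple-root Δδ))
      (subst (λ x → 0# < c · x) (sym (inverseˡ δ)) (simple-positive Δδ))

    -- Pulled back along w, `e` vanishes at the preimage of α, a nonzero point of the cone of Δ,
    -- although it is positive at every simple δ with wδ other than α. So some wδ equals α.
    exposed⇒simple : ∀ {e α} → Φ α → 0# < f · α → Exposes f e α → image w Δ α
    exposed⇒simple {e} {α} Φα 0<fα (eα≡0 , exposes) =
      [ (λ (δ , Δδ , wδ≡α) → δ , Δδ , sym wδ≡α)
      , [ (λ 0<eα → ⊥-elim (0<⇒≢0 0<eα (trans (cong (e ·_) (inverseʳ α)) eα≡0)))
        , (λ w⁻¹α≡0 → ⊥-elim (nonzero (w⁻¹-root Φα) w⁻¹α≡0)) ]′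
      ]′ (cone-positive (pullback e) (λ δ → w δ ≡ α) equal-or-positive (positive-cone (w⁻¹-root Φα) 0<cw⁻¹α))
      where
      0<cw⁻¹α : 0# < c · w⁻¹ α
      0<cw⁻¹α = [ id , (λ (_ , 0<c-w⁻¹α) → ⊥-elim (pos∧neg 0<fα (inj₁ (subst (0# <_) (·-neg f α)
          (carries (root-neg Φα) (subst (λ x → 0# < c · x) (sym (w⁻¹-neg α)) 0<c-w⁻¹α)))))) ]′
        (positive⊎negative (w⁻¹-root Φα))

      equal-or-positive : ∀ {δ} → Δ δ → w δ ≡ α ⊎ 0# < e · w δ
      equal-or-positive {δ} Δδ with w δ ≟ᵛ α
      ... | yes wδ≡α = inj₁ wδ≡α
      ... | no  wδ≢α = inj₂ (exposes (w-root (simple-root Δδ)) (simple-image-positive Δδ) wδ≢α)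

    images-obtuse : ∀ {x y} → image w Δ x → image w Δ y → x ≢ y → 0# ≤ - (x · y)
    images-obtuse (δ , Δδ , x≡wδ) (ε , Δε , y≡wε) x≢y = subst (λ r → 0# ≤ - r)
      (trans (sym (isometry δ ε)) (cong₂ _·_ (sym x≡wδ) (sym y≡wε)))
      (simple-obtuse Δδ Δε (λ δ≡ε → x≢y (trans x≡wδ (trans (cong w δ≡ε) (sym y≡wε)))))

    -- Any further image of a simple root is f-positive and obtuse to both α and β, so the last
    -- premise denies that it is c-positive.
    positive-images : ∀ {α β} → Φ⁺ α → Φ⁺ β → image w Δ α → image w Δ β →
      (∀ {δ} → Φ δ → 0# < f · δ → 0# ≤ - (α · δ) → 0# ≤ - (β · δ) → 0# ≤ - (c · δ)) →
      (image w Δ ∩ Φ⁺) ≐ (｛ α ｝ ∪ ｛ β ｝)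
    positive-images {α} {β} Φ⁺α Φ⁺β wΔα wΔβ c-nonpos =
      (λ {x} (wΔx , Φ⁺x) → only x wΔx Φ⁺x (α ≟ᵛ x) (β ≟ᵛ x)) ,
      [ (λ α≡x → subst (image w Δ ∩ Φ⁺) α≡x (wΔα , Φ⁺α))
      , (λ β≡x → subst (image w Δ ∩ Φ⁺) β≡x (wΔβ , Φ⁺β)) ]′
      where
      only : ∀ x → image w Δ x → Φ⁺ x → Dec (α ≡ x) → Dec (β ≡ x) → α ≡ x ⊎ β ≡ x
      only x _ _ (yes α≡x) _         = inj₁ α≡x
      only x _ _ _         (yes β≡x) = inj₂ β≡x
      only x wΔx@(δ , Δδ , x≡wδ) Φ⁺x (no α≢x) (no β≢x) =
        ⊥-elim (pos∧neg (proj₂ (proj₁ Φ⁺≐ Φ⁺x)) (c-nonpos (proj₁ (proj₁ Φ⁺≐ Φ⁺x))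
          (subst (λ y → 0# < f · y) (sym x≡wδ) (simple-image-positive Δδ))
          (images-obtuse wΔα wΔx α≢x) (images-obtuse wΔβ wΔx β≢x)))

  exposing⇒simple : ∀ {α β} → Φ⁺ α → Φ⁺ β → Exposing c α β →
    ∃ λ (w : V → V) → Weyl Φ w × (image w Δ ∩ Φ⁺) ≐ (｛ α ｝ ∪ ｛ β ｝)
  exposing⇒simple {α} {β} Φ⁺α Φ⁺β exposing =
    let open Exposing exposing renaming (regular to f-regular)
        E , carries = transitive f f-regular
    in WeylElement.w E , WeylElement.weyl E , positive-images E {f} carries Φ⁺α Φ⁺β
         (exposed⇒simple E {f} carries {proj₁ exposes-α} (proj₁ (proj₁ Φ⁺≐ Φ⁺α)) 0<fα (proj₂ exposes-α))
         (exposed⇒simple E {f} carries {proj₁ exposes-β} (proj₁ (proj₁ Φ⁺≐ Φ⁺β)) 0<fβ (proj₂ exposes-β))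
         c-nonpos

  incomparable⇒simple : ∀ {α β} → Φ⁺ α → Φ⁺ β → Incomparable Φ⁺ α β →
    ∃ λ (w : V → V) → Weyl Φ w × (image w Δ ∩ Φ⁺) ≐ (｛ α ｝ ∪ ｛ β ｝)
  incomparable⇒simple {α} {β} Φ⁺α Φ⁺β incomparable = exposing⇒simple Φ⁺α Φ⁺β
    (exposing (incomparable⇒separated Φ⁺α Φ⁺β incomparable) {c} regular
      (proj₂ (proj₁ Φ⁺≐ Φ⁺α)) (proj₂ (proj₁ Φ⁺≐ Φ⁺β)))

theorem6p11 : (R : Reals) (n : ℕ) → let open RootSystems R n in
    (Φ Φ⁺ Δ : Subset) →
    IsRootSystem Φ → Irreducible Φ → Crystallographic Φ →
    IsPositiveSystem Φ Φ⁺ → IsSimpleSystem Φ⁺ Δ →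
    (α β : V) → Φ⁺ α → Φ⁺ β → Incomparable Φ⁺ α β →
    ∃ λ (w : V → V) → Weyl Φ w × (image w Δ ∩ Φ⁺) ≐ (｛ α ｝ ∪ ｛ β ｝)
theorem6p11 R n Φ Φ⁺ Δ isRootSystem _ crystallographic isPositiveSystem isSimpleSystem α β =
  incomparable⇒simple
  where open Transitivity R n isRootSystem crystallographic isPositiveSystem isSimpleSystem
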